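{- Let $a\in\mathbb{Z}_{\geq -1}$, let $\rho$ be the largest root of $x^3-ax^2-(a+3)x-1$, let $K=\mathbb{Q}(\rho)$, and assume that $\mathcal{O}_K=\mathbb{Z}[\rho]$. Then the element $1+\rho+\rho^2$ is indecomposable in $\mathcal{O}_K$. Moreover, $$\min_{\delta\in\mathcal{O}_K^{\vee,+}}\mathrm{Tr}\big((1+\rho+\rho^2)\delta\big)=2.$$
   Context: The field $K$ is totally real. An element of $K$ is totally positive if all its images under embeddings $K\hookrightarrow\mathbb{R}$ are positive; $\mathcal{O}_K^+$ is the set of totally positive elements of $\mathcal{O}_K$. An element $\alpha\in\mathcal{O}_K^+$ is indecomposable if it cannot be written as $\alpha=\beta+\gamma$ with $\beta,\gamma\in\mathcal{O}_K^+$. $\mathrm{Tr}$ is the trace from $K$ to $\mathbb{Q}$. The codifferent is $\mathcal{O}_K^{\vee}=\{\delta\in K\mid \mathrm{Tr}(\alpha\delta)\in\mathbb{Z}\text{ for all }\alpha\in\mathcal{O}_K\}$, and $\mathcal{O}_K^{\vee,+}$ is the set of its totally positive elements. -}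

module Defs where

open import Algebra.Bundles.Raw using (RawRing)
import Algebra.Definitions.RawMonoid as RawMonoidDefs
open import Algebra.Morphism.Structures using (module RingMorphisms)
open import Data.Fin.Base using (Fin)
open import Data.Integer.Base as ℤ using (ℤ; 1ℤ; -1ℤ)
open import Data.List.Base using (List; []; _∷_; _++_)
open import Data.Nat.Base as ℕ using (ℕ)
import Data.Nat.Properties as ℕ
open import Data.Product.Base using (Σ; ∃; ∃-syntax; _×_; _,_; proj₁; proj₂)
open import Data.Rational.Base as ℚ using (ℚ; 0ℚ; 1ℚ; ½; ∣_∣)
import Data.Rational.Properties as ℚ
open import Level using (0ℓ)
open import Relation.Binary.PropositionalEquality
  using (_≡_; refl; sym; trans; cong; cong₂; subst)
open import Relation.Nullary.Negation.Core using (¬_)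
open import Relation.Unary using (Pred; _∈_)

import Data.Rational.Solver as ℚ-Solver

------------------------------------------------------------------------
-- Real numbers: Cauchy sequences of rationals, equal when their difference
-- tends to 0.

Eventually : Pred ℕ 0ℓ → Set
Eventually P = ∃[ N ] (∀ n → N ℕ.≤ n → P n)

Within : (ℕ → ℚ) → ℚ → ℕ → Set
Within x ε N = ∀ m n → N ℕ.≤ m → N ℕ.≤ n → ∣ x m ℚ.- x n ∣ ℚ.< ε

IsCauchy : (ℕ → ℚ) → Set
IsCauchy x = ∀ ε → 0ℚ ℚ.< ε → ∃ (Within x ε)

record ℝ : Set where
  constructor mkℝ
  field
    seq      : ℕ → ℚ
    isCauchy : IsCauchy seq

open ℝ public

infix  4 _≃_ _<_ _≤_
infixl 6 _+_
infixl 7 _*_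
infix  8 -_

_≃_ : ℝ → ℝ → Set
x ≃ y = ∀ ε → 0ℚ ℚ.< ε → Eventually (λ n → ∣ seq x n ℚ.- seq y n ∣ ℚ.< ε)

_<_ : ℝ → ℝ → Set
x < y = ∃[ ε ] (0ℚ ℚ.< ε × Eventually (λ n → seq x n ℚ.+ ε ℚ.< seq y n))

_≤_ : ℝ → ℝ → Set
x ≤ y = ¬ (y < x)

private
  halves : ∀ ε → ε ℚ.* ½ ℚ.+ ε ℚ.* ½ ≡ ε
  halves ε = trans (sym (ℚ.*-distribˡ-+ ε ½ ½)) (ℚ.*-identityʳ ε)

  half-pos : ∀ {ε} → 0ℚ ℚ.< ε → 0ℚ ℚ.< ε ℚ.* ½
  half-pos {ε} 0<ε = ℚ.*-monoˡ-<-pos ½ 0<ε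

  diff-+ : ∀ a b c d → (a ℚ.+ b) ℚ.- (c ℚ.+ d) ≡ (a ℚ.- c) ℚ.+ (b ℚ.- d)
  diff-+ = solve 4 (λ a b c d → (a :+ b) :- (c :+ d) := (a :- c) :+ (b :- d)) refl
    where open ℚ-Solver.+-*-Solver

  diff-neg : ∀ a b → (ℚ.- a) ℚ.- (ℚ.- b) ≡ ℚ.- (a ℚ.- b)
  diff-neg = solve 2 (λ a b → (:- a) :- (:- b) := :- (a :- b)) refl
    where open ℚ-Solver.+-*-Solver

  diff-* : ∀ a b c d →
    (a ℚ.* b) ℚ.- (c ℚ.* d) ≡ a ℚ.* (b ℚ.- d) ℚ.+ (a ℚ.- c) ℚ.* d
  diff-* = solve 4 (λ a b c d →
    (a :* b) :- (c :* d) := a :* (b :- d) :+ (a :- c) :* d) refl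
    where open ℚ-Solver.+-*-Solver

  split : ∀ a b → a ≡ (a ℚ.- b) ℚ.+ b
  split = solve 2 (λ a b → a := (a :- b) :+ b) refl
    where open ℚ-Solver.+-*-Solver

  *-positive : ∀ {p q} → 0ℚ ℚ.< p → 0ℚ ℚ.< q → 0ℚ ℚ.< p ℚ.* q
  *-positive {p} {q} 0<p 0<q =
    subst (ℚ._< p ℚ.* q) (ℚ.*-zeroˡ q) (ℚ.*-monoˡ-<-pos q {{ℚ.positive 0<q}} 0<p)

  Bounds : (ℕ → ℚ) → ℚ → ℕ → Set
  Bounds x B N = ∀ n → N ℕ.≤ n → ∣ x n ∣ ℚ.≤ B

  bounded : ∀ {x} → ∃ (Within x 1ℚ) → ∃[ B ] (0ℚ ℚ.< B × ∃ (Bounds x B))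
  bounded {x} (N , p) = 1ℚ ℚ.+ ∣ x N ∣
    , ℚ.+-mono-<-≤ (ℚ.positive⁻¹ 1ℚ) (ℚ.0≤∣p∣ (x N)) , N , bound
    where
    open ℚ.≤-Reasoning
    bound : Bounds x (1ℚ ℚ.+ ∣ x N ∣) N
    bound n N≤n = begin
      ∣ x n ∣                      ≡⟨ cong ∣_∣ (split (x n) (x N)) ⟩
      ∣ (x n ℚ.- x N) ℚ.+ x N ∣    ≤⟨ ℚ.∣p+q∣≤∣p∣+∣q∣ (x n ℚ.- x N) (x N) ⟩
      ∣ x n ℚ.- x N ∣ ℚ.+ ∣ x N ∣  ≤⟨ ℚ.+-monoˡ-≤ ∣ x N ∣ (ℚ.<⇒≤ (p n N N≤n ℕ.≤-refl)) ⟩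
      1ℚ ℚ.+ ∣ x N ∣               ∎

  divide : ∀ B → .{{_ : ℚ.Positive B}} → ∀ ε → 0ℚ ℚ.< ε →
    ∃[ η ] (0ℚ ℚ.< η × B ℚ.* η ℚ.+ η ℚ.* B ≡ ε)
  divide B ε 0<ε = ε ℚ.* ½ ℚ.* B⁻¹
    , *-positive (half-pos 0<ε) (ℚ.positive⁻¹ B⁻¹ {{ℚ.1/pos⇒pos B}})
    , trans (cong₂ ℚ._+_ (trans (ℚ.*-comm B (ε ℚ.* ½ ℚ.* B⁻¹)) ηB) ηB) (halves ε)
    where
    B⁻¹ : ℚ
    B⁻¹ = ℚ.1/_ B {{ℚ.pos⇒nonZero B}}

    ηB : ε ℚ.* ½ ℚ.* B⁻¹ ℚ.* B ≡ ε ℚ.* ½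
    ηB = trans (ℚ.*-assoc (ε ℚ.* ½) B⁻¹ B)
           (trans (cong (ε ℚ.* ½ ℚ.*_) (ℚ.*-inverseˡ B {{ℚ.pos⇒nonZero B}}))
                  (ℚ.*-identityʳ (ε ℚ.* ½)))

  sum-close : ∀ {ε} a b c d → ∣ a ℚ.- c ∣ ℚ.< ε ℚ.* ½ → ∣ b ℚ.- d ∣ ℚ.< ε ℚ.* ½ →
    ∣ (a ℚ.+ b) ℚ.- (c ℚ.+ d) ∣ ℚ.< ε
  sum-close {ε} a b c d p q = begin-strict
    ∣ (a ℚ.+ b) ℚ.- (c ℚ.+ d) ∣        ≡⟨ cong ∣_∣ (diff-+ a b c d) ⟩
    ∣ (a ℚ.- c) ℚ.+ (b ℚ.- d) ∣        ≤⟨ ℚ.∣p+q∣≤∣p∣+∣q∣ (a ℚ.- c) (b ℚ.- d) ⟩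
    ∣ a ℚ.- c ∣ ℚ.+ ∣ b ℚ.- d ∣        <⟨ ℚ.+-mono-< p q ⟩
    ε ℚ.* ½ ℚ.+ ε ℚ.* ½                ≡⟨ halves ε ⟩
    ε                                  ∎
    where open ℚ.≤-Reasoning

  product-close : ∀ {ε η B} .{{_ : ℚ.Positive B}} .{{_ : ℚ.NonNegative B}} a b c d →
    B ℚ.* η ℚ.+ η ℚ.* B ≡ ε → ∣ a ∣ ℚ.≤ B → ∣ d ∣ ℚ.≤ B →
    ∣ a ℚ.- c ∣ ℚ.< η → ∣ b ℚ.- d ∣ ℚ.< η → ∣ a ℚ.* b ℚ.- c ℚ.* d ∣ ℚ.< ε
  product-close {ε} {η} {B} a b c d eq a≤B d≤B p q = begin-strict
    ∣ a ℚ.* b ℚ.- c ℚ.* d ∣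
      ≡⟨ cong ∣_∣ (diff-* a b c d) ⟩
    ∣ a ℚ.* (b ℚ.- d) ℚ.+ (a ℚ.- c) ℚ.* d ∣
      ≤⟨ ℚ.∣p+q∣≤∣p∣+∣q∣ (a ℚ.* (b ℚ.- d)) ((a ℚ.- c) ℚ.* d) ⟩
    ∣ a ℚ.* (b ℚ.- d) ∣ ℚ.+ ∣ (a ℚ.- c) ℚ.* d ∣
      ≡⟨ cong₂ ℚ._+_ (ℚ.∣p*q∣≡∣p∣*∣q∣ a (b ℚ.- d)) (ℚ.∣p*q∣≡∣p∣*∣q∣ (a ℚ.- c) d) ⟩
    ∣ a ∣ ℚ.* ∣ b ℚ.- d ∣ ℚ.+ ∣ a ℚ.- c ∣ ℚ.* ∣ d ∣
      ≤⟨ ℚ.+-mono-≤ (ℚ.*-monoʳ-≤-nonNeg ∣ b ℚ.- d ∣ {{ℚ.∣-∣-nonNeg (b ℚ.- d)}} a≤B)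
                    (ℚ.*-monoˡ-≤-nonNeg ∣ a ℚ.- c ∣ {{ℚ.∣-∣-nonNeg (a ℚ.- c)}} d≤B) ⟩
    B ℚ.* ∣ b ℚ.- d ∣ ℚ.+ ∣ a ℚ.- c ∣ ℚ.* B
      <⟨ ℚ.+-mono-< (ℚ.*-monoʳ-<-pos B q) (ℚ.*-monoˡ-<-pos B p) ⟩
    B ℚ.* η ℚ.+ η ℚ.* B
      ≡⟨ eq ⟩
    ε ∎
    where open ℚ.≤-Reasoning

  +-within : ∀ {x y ε} → ∃ (Within x (ε ℚ.* ½)) → ∃ (Within y (ε ℚ.* ½)) →
    ∃ (Within (λ n → x n ℚ.+ y n) ε)
  +-within {x} {y} {ε} (M₁ , p₁) (M₂ , p₂) = M₁ ℕ.⊔ M₂ , λ m n hm hn →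
    sum-close {ε} (x m) (y m) (x n) (y n)
      (p₁ m n (ℕ.m⊔n≤o⇒m≤o M₁ M₂ hm) (ℕ.m⊔n≤o⇒m≤o M₁ M₂ hn))
      (p₂ m n (ℕ.m⊔n≤o⇒n≤o M₁ M₂ hm) (ℕ.m⊔n≤o⇒n≤o M₁ M₂ hn))

  *-within : ∀ {x y ε η B} → .{{_ : ℚ.Positive B}} → .{{_ : ℚ.NonNegative B}} →
    B ℚ.* η ℚ.+ η ℚ.* B ≡ ε →
    ∃ (Bounds x B) → ∃ (Bounds y B) → ∃ (Within x η) → ∃ (Within y η) →
    ∃ (Within (λ n → x n ℚ.* y n) ε)
  *-within {x} {y} {ε} {η} {B} eq (N₁ , b₁) (N₂ , b₂) (M₁ , p₁) (M₂ , p₂) =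
    (N₁ ℕ.⊔ N₂) ℕ.⊔ (M₁ ℕ.⊔ M₂) , λ m n hm hn →
    product-close {ε} {η} {B} (x m) (y m) (x n) (y n) eq
      (b₁ m (ℕ.m⊔n≤o⇒m≤o N₁ N₂ (lower hm)))
      (b₂ n (ℕ.m⊔n≤o⇒n≤o N₁ N₂ (lower hn)))
      (p₁ m n (ℕ.m⊔n≤o⇒m≤o M₁ M₂ (upper hm)) (ℕ.m⊔n≤o⇒m≤o M₁ M₂ (upper hn)))
      (p₂ m n (ℕ.m⊔n≤o⇒n≤o M₁ M₂ (upper hm)) (ℕ.m⊔n≤o⇒n≤o M₁ M₂ (upper hn)))
    where
    lower : ∀ {k} → (N₁ ℕ.⊔ N₂) ℕ.⊔ (M₁ ℕ.⊔ M₂) ℕ.≤ k → N₁ ℕ.⊔ N₂ ℕ.≤ k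
    lower = ℕ.m⊔n≤o⇒m≤o (N₁ ℕ.⊔ N₂) (M₁ ℕ.⊔ M₂)
    upper : ∀ {k} → (N₁ ℕ.⊔ N₂) ℕ.⊔ (M₁ ℕ.⊔ M₂) ℕ.≤ k → M₁ ℕ.⊔ M₂ ℕ.≤ k
    upper = ℕ.m⊔n≤o⇒n≤o (N₁ ℕ.⊔ N₂) (M₁ ℕ.⊔ M₂)

  *-cauchy : ∀ {x y} → IsCauchy x → IsCauchy y →
    ∃[ B ] (0ℚ ℚ.< B × ∃ (Bounds x B)) → ∃[ B ] (0ℚ ℚ.< B × ∃ (Bounds y B)) →
    IsCauchy (λ n → x n ℚ.* y n)
  *-cauchy {x} {y} cx cy (B₁ , 0<B₁ , N₁ , b₁) (B₂ , 0<B₂ , N₂ , b₂) ε 0<ε =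
    conclude (divide B {{B-pos}} ε 0<ε)
    where
    B : ℚ
    B = B₁ ℚ.+ B₂

    B-pos : ℚ.Positive B
    B-pos = ℚ.positive (ℚ.+-mono-< 0<B₁ 0<B₂)

    B₁≤B : B₁ ℚ.≤ B
    B₁≤B = subst (ℚ._≤ B) (ℚ.+-identityʳ B₁) (ℚ.+-monoʳ-≤ B₁ (ℚ.<⇒≤ 0<B₂))

    B₂≤B : B₂ ℚ.≤ B
    B₂≤B = subst (ℚ._≤ B) (ℚ.+-identityˡ B₂) (ℚ.+-monoˡ-≤ B₂ (ℚ.<⇒≤ 0<B₁))

    conclude : ∃[ η ] (0ℚ ℚ.< η × B ℚ.* η ℚ.+ η ℚ.* B ≡ ε) →
      ∃ (Within (λ n → x n ℚ.* y n) ε)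
    conclude (η , 0<η , eq) =
      *-within {x} {y} {ε} {η} {B} {{B-pos}} {{ℚ.pos⇒nonNeg B {{B-pos}}}} eq
        (N₁ , λ n h → ℚ.≤-trans (b₁ n h) B₁≤B)
        (N₂ , λ n h → ℚ.≤-trans (b₂ n h) B₂≤B)
        (cx η 0<η) (cy η 0<η)

  neg-within : ∀ {x ε} → ∃ (Within x ε) → ∃ (Within (λ n → ℚ.- x n) ε)
  neg-within {x} {ε} (M , p) = M , λ m n hm hn →
    subst (ℚ._< ε)
      (sym (trans (cong ∣_∣ (diff-neg (x m) (x n))) (ℚ.∣-p∣≡∣p∣ (x m ℚ.- x n))))
      (p m n hm hn)

abstract
  const-isCauchy : (q : ℚ) → IsCauchy (λ _ → q)
  const-isCauchy q ε 0<ε = 0 , λ _ _ _ _ →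
    subst (λ r → ∣ r ∣ ℚ.< ε) (sym (ℚ.+-inverseʳ q)) 0<ε

  +-isCauchy : ∀ {x y} → IsCauchy x → IsCauchy y → IsCauchy (λ n → x n ℚ.+ y n)
  +-isCauchy {x} {y} cx cy ε 0<ε =
    +-within {x} {y} {ε} (cx (ε ℚ.* ½) (half-pos 0<ε)) (cy (ε ℚ.* ½) (half-pos 0<ε))

  *-isCauchy : ∀ {x y} → IsCauchy x → IsCauchy y → IsCauchy (λ n → x n ℚ.* y n)
  *-isCauchy {x} {y} cx cy = *-cauchy {x} {y} cx cy
    (bounded {x} (cx 1ℚ (ℚ.positive⁻¹ 1ℚ))) (bounded {y} (cy 1ℚ (ℚ.positive⁻¹ 1ℚ)))

  neg-isCauchy : ∀ {x} → IsCauchy x → IsCauchy (λ n → ℚ.- x n)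
  neg-isCauchy {x} cx ε 0<ε = neg-within {x} {ε} (cx ε 0<ε)

fromℚ : ℚ → ℝ
fromℚ q = mkℝ (λ _ → q) (const-isCauchy q)

fromℤ : ℤ → ℝ
fromℤ z = fromℚ (z ℚ./ 1)

_+_ : ℝ → ℝ → ℝ
x + y = mkℝ (λ n → seq x n ℚ.+ seq y n) (+-isCauchy {seq x} {seq y} (isCauchy x) (isCauchy y))

_*_ : ℝ → ℝ → ℝ
x * y = mkℝ (λ n → seq x n ℚ.* seq y n) (*-isCauchy {seq x} {seq y} (isCauchy x) (isCauchy y))

-_ : ℝ → ℝ
- x = mkℝ (λ n → ℚ.- seq x n) (neg-isCauchy {seq x} (isCauchy x))

0ℝ 1ℝ : ℝ
0ℝ = fromℚ 0ℚ
1ℝ = fromℚ 1ℚ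

ℝ-rawRing : RawRing 0ℓ 0ℓ
ℝ-rawRing = record
  { Carrier = ℝ ; _≈_ = _≃_
  ; _+_ = _+_ ; _*_ = _*_ ; -_ = -_ ; 0# = 0ℝ ; 1# = 1ℝ }

------------------------------------------------------------------------
-- Integer polynomials, given by their coefficients from the constant term up.

eval : List ℤ → ℝ → ℝ
eval []       x = 0ℝ
eval (c ∷ cs) x = fromℤ c + x * eval cs x

IsLargestRoot : List ℤ → ℝ → Set
IsLargestRoot p x = eval p x ≃ 0ℝ × (∀ y → eval p y ≃ 0ℝ → y ≤ x)

-- x³ - a x² - (a + 3) x - 1
simplestCubic : ℤ → List ℤ
simplestCubic a = -1ℤ ∷ ℤ.- (a ℤ.+ ℤ.+ 3) ∷ ℤ.- a ∷ 1ℤ ∷ []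

IsMinimum : Pred ℚ 0ℓ → ℚ → Set
IsMinimum S m = m ∈ S × (∀ t → t ∈ S → m ℚ.≤ t)

------------------------------------------------------------------------
-- The smallest subfield of ℝ containing ρ. Invertibility is witnessed by an
-- explicit inverse; `resp` makes membership independent of the Cauchy sequence
-- chosen to represent a real.

infix 4 _∈ℚ⟨_⟩

data _∈ℚ⟨_⟩ : ℝ → ℝ → Set where
  gen  : ∀ {ρ} → ρ ∈ℚ⟨ ρ ⟩
  rat  : ∀ {ρ} q → fromℚ q ∈ℚ⟨ ρ ⟩
  add  : ∀ {ρ x y} → x ∈ℚ⟨ ρ ⟩ → y ∈ℚ⟨ ρ ⟩ → x + y ∈ℚ⟨ ρ ⟩
  mul  : ∀ {ρ x y} → x ∈ℚ⟨ ρ ⟩ → y ∈ℚ⟨ ρ ⟩ → x * y ∈ℚ⟨ ρ ⟩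
  neg  : ∀ {ρ x} → x ∈ℚ⟨ ρ ⟩ → - x ∈ℚ⟨ ρ ⟩
  inv  : ∀ {ρ x y} → x ∈ℚ⟨ ρ ⟩ → x * y ≃ 1ℝ → y ∈ℚ⟨ ρ ⟩
  resp : ∀ {ρ x y} → x ≃ y → x ∈ℚ⟨ ρ ⟩ → y ∈ℚ⟨ ρ ⟩

module NumberField (ρ : ℝ) where

  record K : Set where
    constructor _by_
    field
      value  : ℝ
      member : value ∈ℚ⟨ ρ ⟩

  open K public

  infix  4 _≈ᴷ_
  infixl 6 _+ᴷ_
  infixl 7 _*ᴷ_
  infix  8 -ᴷ_

  _≈ᴷ_ : K → K → Set
  x ≈ᴷ y = value x ≃ value y

  _+ᴷ_ _*ᴷ_ : K → K → K
  (x by p) +ᴷ (y by q) = (x + y) by add p q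
  (x by p) *ᴷ (y by q) = (x * y) by mul p q

  -ᴷ_ : K → K
  -ᴷ (x by p) = (- x) by neg p

  0ᴷ 1ᴷ ρᴷ : K
  0ᴷ = 0ℝ by rat 0ℚ
  1ᴷ = 1ℝ by rat 1ℚ
  ρᴷ = ρ by gen

  K-rawRing : RawRing 0ℓ 0ℓ
  K-rawRing = record
    { Carrier = K ; _≈_ = _≈ᴷ_
    ; _+_ = _+ᴷ_ ; _*_ = _*ᴷ_ ; -_ = -ᴷ_ ; 0# = 0ᴷ ; 1# = 1ᴷ }

  IsRealEmbedding : (K → ℝ) → Set
  IsRealEmbedding = IsRingMonomorphism
    where open RingMorphisms K-rawRing ℝ-rawRing

  TotallyPositive : Pred K 0ℓ
  TotallyPositive x = ∀ σ → IsRealEmbedding σ → 0ℝ < σ x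

  -- The polynomial is p + xⁿ with n = length p, so an arbitrary monic one.
  𝒪 : Pred K 0ℓ
  𝒪 x = ∃[ p ] eval (p ++ 1ℤ ∷ []) (value x) ≃ 0ℝ

  𝒪⁺ : Pred K 0ℓ
  𝒪⁺ x = x ∈ 𝒪 × TotallyPositive x

  ℤ[ρ] : Pred K 0ℓ
  ℤ[ρ] x = ∃[ p ] value x ≃ eval p ρ

  Indecomposable : Pred K 0ℓ
  Indecomposable x = x ∈ 𝒪⁺ ×
    ¬ (∃[ y ] ∃[ z ] (y ∈ 𝒪⁺ × z ∈ 𝒪⁺ × x ≈ᴷ y +ᴷ z))

  ----------------------------------------------------------------------
  -- The trace of K over ℚ: x has trace t when t is the trace of the matrix of
  -- multiplication by x with respect to a ℚ-basis of K. It is a relation since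
  -- the coordinates of an element of K ⊆ ℝ are not part of its data.

  sumℝ : ∀ {n} → (Fin n → ℝ) → ℝ
  sumℝ = RawMonoidDefs.sum (RawRing.+-rawMonoid ℝ-rawRing)

  sumℚ : ∀ {n} → (Fin n → ℚ) → ℚ
  sumℚ = RawMonoidDefs.sum ℚ.+-0-rawMonoid

  combination : ∀ {n} → (Fin n → ℚ) → (Fin n → K) → ℝ
  combination c e = sumℝ (λ i → fromℚ (c i) * value (e i))

  record IsBasis {n} (e : Fin n → K) : Set where
    field
      spanning    : ∀ x → ∃[ c ] value x ≃ combination c e
      independent : ∀ c → combination c e ≃ 0ℝ → ∀ i → c i ≡ 0ℚ

  HasTrace : K → ℚ → Set
  HasTrace x t =
    Σ ℕ λ n → Σ (Fin n → K) λ e → IsBasis e ×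
    Σ (Fin n → Fin n → ℚ) λ M →
      (∀ j → value (x *ᴷ e j) ≃ combination (λ i → M i j) e) ×
      t ≡ sumℚ (λ i → M i i)

  𝒪^∨ : Pred K 0ℓ
  𝒪^∨ δ = ∀ α → α ∈ 𝒪 → ∃[ z ] HasTrace (α *ᴷ δ) (z ℚ./ 1)

  𝒪^∨⁺ : Pred K 0ℓ
  𝒪^∨⁺ δ = δ ∈ 𝒪^∨ × TotallyPositive δ

{-# OPTIONS --safe #-}
module Submission where

-- Put φ(x + yρ + zρ²) = 2x - y + z, which is the functional Tr(δ ·) for the
-- totally positive element δ = 1/ω² of the codifferent; φ(ω) = 2. The functionals
-- v ↦ φ(ρ²v) and v ↦ φ((1 + ρ)²v) also take the value 2 at ω. If ω = u + v, all three
-- are positive integers at u and v, hence equal to 1 at u; as they span the dual,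
-- 2u = ω, which has an odd coordinate. Conversely 2ω = 1 + ρ² + (1 + ρ)² is a sum of
-- three totally positive integers, so 2 Tr(ωγ) ≥ 3 for γ ∈ 𝒪^∨⁺.
--
-- All of this takes place in ℚ³, the coordinates with respect to 1, ρ, ρ². They are
-- unique because the cubic is irreducible modulo 2, so that its norm form has no
-- nontrivial zero by descent; therefore every root r gives an embedding ρ ↦ r of K, and
-- the trace is the sum over ρ, -1 - 1/ρ and -1/(1 + ρ).

open import Defs
import Algebra.Definitions.RawMonoid as RawMonoidDefs
open import Algebra.Bundles.Raw using (RawRing)
open import Algebra.Morphism.Structures using (module RingMorphisms)
open import Data.Empty using (⊥)
open import Data.Fin.Base using (Fin; zero; suc)
open import Data.Integer.Base as ℤ using (ℤ; 0ℤ; 1ℤ; -1ℤ)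
import Data.Integer.Properties as ℤ
import Data.Integer.Solver as ℤ-Solver
open import Data.List.Base using ([]; _∷_)
open import Data.Nat.Base as ℕ using (ℕ; zero; suc; z≤n; s≤s)
import Data.Nat.Properties as ℕ
import Data.Nat.Solver as ℕ-Solver
open import Data.Parity.Base as ℙ using (Parity; 0ℙ; 1ℙ)
import Data.Parity.Properties as ℙ
open import Data.Product.Base using (_×_; ∃-syntax; _,_; proj₁; proj₂)
open import Data.Rational.Base as ℚ using (ℚ; 0ℚ; 1ℚ; ½; ∣_∣; _/_)
import Data.Rational.Properties as ℚ
open import Data.Rational.Solver renaming (module +-*-Solver to ℚ-Solver)
import Data.Rational.Unnormalised.Base as ℚᵘ
import Data.Rational.Unnormalised.Properties as ℚᵘ
open import Data.Sum.Base using (inj₁; inj₂)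
open import Function.Base using (_∘_)
open import Function.Bundles using (_⇔_; module Equivalence)
open import Level using (0ℓ)
open import Relation.Binary.Bundles using (Setoid)
open import Relation.Binary.Definitions using (tri<; tri≈; tri>)
open import Relation.Binary.PropositionalEquality
  using (_≡_; _≢_; refl; sym; trans; cong; cong₂; subst; subst₂; module ≡-Reasoning)
import Relation.Binary.Reasoning.Setoid as SetoidReasoning
open import Relation.Nullary.Decidable.Core using (Dec; yes; no)
open import Relation.Nullary.Negation.Core using (contradiction)
open import Relation.Unary using (_∈_)

-- Cauchy reals

-- The element 1/ω² comes from the different. With ρ′ = -1 - 1/ρ and ρ″ = -1/(1 + ρ), the
-- differences of conjugates are ρ - ρ′ = ω/ρ and ρ - ρ″ = ω/(1 + ρ), so the derivative of the cubic
-- at ρ is ω²/(ρ(1 + ρ)). Since ρ and 1 + ρ are units, 1/ω² is a totally positive generator of the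
-- codifferent of ℤ[ρ], and multiplying it by the squares of these units gives the other two
-- functionals. Several functionals are called for because the minimum is 2: a trace of 1 would
-- forbid a decomposition at once, whereas a trace of 2 leaves the splitting 1 + 1, which is
-- excluded only by comparing independent functionals. Two features of the setting shape the rest.
-- Equality of Cauchy reals cannot be decided, so every case distinction is made on rational
-- coordinates. Total positivity quantifies over all embeddings: as a hypothesis it is applied to
-- the embeddings built from roots, while ω and 1/ω² are proved positive under an abstract σ from
-- σ(ω) = 1 + σ(ρ) + σ(ρ)² and δω² = 1.

private variable
  x x′ y y′ : ℝ

eventually-∩ : ∀ {P Q R : ℕ → Set} → (∀ n → P n → Q n → R n) →
  Eventually P → Eventually Q → Eventually R
eventually-∩ f (M , p) (N , q) = M ℕ.⊔ N , λ n h →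
  f n (p n (ℕ.m⊔n≤o⇒m≤o M N h)) (q n (ℕ.m⊔n≤o⇒n≤o M N h))

eventually-map : ∀ {P Q : ℕ → Set} → (∀ n → P n → Q n) → Eventually P → Eventually Q
eventually-map f (M , p) = M , λ n h → f n (p n h)

*-pos : ∀ {p q} → 0ℚ ℚ.< p → 0ℚ ℚ.< q → 0ℚ ℚ.< p ℚ.* q
*-pos {p} {q} 0<p 0<q =
  subst (ℚ._< p ℚ.* q) (ℚ.*-zeroˡ q) (ℚ.*-monoˡ-<-pos q {{ℚ.positive 0<q}} 0<p)

0<½ : 0ℚ ℚ.< ½
0<½ = ℚ.positive⁻¹ ½

half+half : ∀ ε → ε ℚ.* ½ ℚ.+ ε ℚ.* ½ ≡ ε
half+half ε = trans (sym (ℚ.*-distribˡ-+ ε ½ ½)) (ℚ.*-identityʳ ε)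

recip : ∀ {p} → 0ℚ ℚ.< p → ∃[ q ] (0ℚ ℚ.< q × p ℚ.* q ≡ 1ℚ)
recip {p} 0<p = 1/p , ℚ.positive⁻¹ 1/p {{ℚ.1/pos⇒pos p {{ℚ.positive 0<p}}}}
  , ℚ.*-inverseʳ p {{nz}}
  where
  nz : ℚ.NonZero p
  nz = ℚ.pos⇒nonZero p {{ℚ.positive 0<p}}
  1/p : ℚ
  1/p = ℚ.1/_ p {{nz}}

Null : (ℕ → ℚ) → Set
Null z = ∀ ε → 0ℚ ℚ.< ε → Eventually (λ n → ∣ z n ∣ ℚ.< ε)

Bounded : (ℕ → ℚ) → Set
Bounded b = ∃[ B ] (0ℚ ℚ.< B × Eventually (λ n → ∣ b n ∣ ℚ.≤ B))

null-cong : ∀ {z w} → (∀ n → z n ≡ w n) → Null w → Null z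
null-cong eq nw ε 0<ε =
  eventually-map (λ n → subst (λ t → ∣ t ∣ ℚ.< ε) (sym (eq n))) (nw ε 0<ε)

null-+ : ∀ {z w} → Null z → Null w → Null (λ n → z n ℚ.+ w n)
null-+ {z} {w} nz nw ε 0<ε = eventually-∩
  (λ n p q → ℚ.≤-<-trans (ℚ.∣p+q∣≤∣p∣+∣q∣ (z n) (w n))
    (subst (∣ z n ∣ ℚ.+ ∣ w n ∣ ℚ.<_) (half+half ε) (ℚ.+-mono-< p q)))
  (nz (ε ℚ.* ½) (*-pos 0<ε 0<½)) (nw (ε ℚ.* ½) (*-pos 0<ε 0<½))

null-neg : ∀ {z} → Null z → Null (λ n → ℚ.- z n)
null-neg {z} nz ε 0<ε =
  eventually-map (λ n → subst (ℚ._< ε) (sym (ℚ.∣-p∣≡∣p∣ (z n)))) (nz ε 0<ε)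

null-* : ∀ {b z} → Bounded b → Null z → Null (λ n → b n ℚ.* z n)
null-* {b} {z} (B , 0<B , bb) nz ε 0<ε with recip 0<B
... | C , 0<C , BC≡1 = eventually-∩ step bb (nz (C ℚ.* ε) (*-pos 0<C 0<ε))
  where
  open ℚ.≤-Reasoning
  step : ∀ n → ∣ b n ∣ ℚ.≤ B → ∣ z n ∣ ℚ.< C ℚ.* ε → ∣ b n ℚ.* z n ∣ ℚ.< ε
  step n p q = begin-strict
    ∣ b n ℚ.* z n ∣      ≡⟨ ℚ.∣p*q∣≡∣p∣*∣q∣ (b n) (z n) ⟩
    ∣ b n ∣ ℚ.* ∣ z n ∣  ≤⟨ ℚ.*-monoʳ-≤-nonNeg ∣ z n ∣ {{ℚ.∣-∣-nonNeg (z n)}} p ⟩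
    B ℚ.* ∣ z n ∣        <⟨ ℚ.*-monoʳ-<-pos B {{ℚ.positive 0<B}} q ⟩
    B ℚ.* (C ℚ.* ε)      ≡⟨ sym (ℚ.*-assoc B C ε) ⟩
    B ℚ.* C ℚ.* ε        ≡⟨ cong (ℚ._* ε) BC≡1 ⟩
    1ℚ ℚ.* ε             ≡⟨ ℚ.*-identityˡ ε ⟩
    ε                    ∎

cauchy-bounded : ∀ x → Bounded (seq x)
cauchy-bounded x with isCauchy x 1ℚ (ℚ.positive⁻¹ 1ℚ)
... | N , p = 1ℚ ℚ.+ ∣ seq x N ∣
    , ℚ.+-mono-<-≤ (ℚ.positive⁻¹ 1ℚ) (ℚ.0≤∣p∣ (seq x N)) , N , bound
  where
  open ℚ.≤-Reasoning
  bound : ∀ n → N ℕ.≤ n → ∣ seq x n ∣ ℚ.≤ 1ℚ ℚ.+ ∣ seq x N ∣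
  bound n N≤n = begin
    ∣ seq x n ∣
      ≡⟨ cong ∣_∣ (solve 2 (λ s t → s := (s :- t) :+ t) refl (seq x n) (seq x N)) ⟩
    ∣ (seq x n ℚ.- seq x N) ℚ.+ seq x N ∣
      ≤⟨ ℚ.∣p+q∣≤∣p∣+∣q∣ (seq x n ℚ.- seq x N) (seq x N) ⟩
    ∣ seq x n ℚ.- seq x N ∣ ℚ.+ ∣ seq x N ∣
      ≤⟨ ℚ.+-monoˡ-≤ ∣ seq x N ∣ (ℚ.<⇒≤ (p n N N≤n ℕ.≤-refl)) ⟩
    1ℚ ℚ.+ ∣ seq x N ∣ ∎
    where open ℚ-Solver

-- _≃_ unfolds to a function type, from which its arguments cannot be inferred.
infix 4 _≈_
record _≈_ (x y : ℝ) : Set where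
  constructor wrap
  field unwrap : x ≃ y

open _≈_ public

-- An identity modulo f ≃ 0, checked at each index with explicit quotient g.
≈-mod : ∀ {f} g → f ≈ 0ℝ → (∀ n → seq x n ≡ seq y n ℚ.+ seq g n ℚ.* seq f n) → x ≈ y
≈-mod {x} {y} {f} g (wrap f≃0) eq = wrap (null-cong {w = λ n → seq g n ℚ.* (seq f n ℚ.- 0ℚ)}
    (λ n → trans (cong (ℚ._- seq y n) (eq n)) (rearrange (seq y n) (seq g n) (seq f n)))
    (null-* {seq g} {λ n → seq f n ℚ.- 0ℚ} (cauchy-bounded g) f≃0))
  where
  rearrange : ∀ b c d → (b ℚ.+ c ℚ.* d) ℚ.- b ≡ c ℚ.* (d ℚ.- 0ℚ)
  rearrange = solve 3 (λ b c d → (b :+ c :* d) :- b := c :* (d :- con 0ℚ)) refl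
    where open ℚ-Solver

≈-pointwise : (∀ n → seq x n ≡ seq y n) → x ≈ y
≈-pointwise {x} {y} eq = wrap λ ε 0<ε → 0 , λ n _ → subst (λ t → ∣ t ∣ ℚ.< ε)
  (sym (trans (cong (ℚ._- seq y n) (eq n)) (ℚ.+-inverseʳ (seq y n)))) 0<ε

≈-refl : x ≈ x
≈-refl = ≈-pointwise λ _ → refl

≈-sym : x ≈ y → y ≈ x
≈-sym {x} {y} (wrap p) = wrap (null-cong (λ n → lemma (seq x n) (seq y n))
    (null-neg {λ n → seq x n ℚ.- seq y n} p))
  where
  lemma : ∀ s t → t ℚ.- s ≡ ℚ.- (s ℚ.- t)
  lemma = solve 2 (λ s t → t :- s := :- (s :- t)) refl
    where open ℚ-Solver

≈-trans : ∀ {x y z} → x ≈ y → y ≈ z → x ≈ z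
≈-trans {x} {y} {z} (wrap p) (wrap q) = wrap
  (null-cong (λ n → lemma (seq x n) (seq y n) (seq z n))
    (null-+ {λ n → seq x n ℚ.- seq y n} {λ n → seq y n ℚ.- seq z n} p q))
  where
  lemma : ∀ s t u → s ℚ.- u ≡ (s ℚ.- t) ℚ.+ (t ℚ.- u)
  lemma = solve 3 (λ s t u → s :- u := (s :- t) :+ (t :- u)) refl
    where open ℚ-Solver

+-cong : x ≈ x′ → y ≈ y′ → x + y ≈ x′ + y′
+-cong {x} {x′} {y} {y′} (wrap p) (wrap q) = wrap
  (null-cong (λ n → lemma (seq x n) (seq x′ n) (seq y n) (seq y′ n))
    (null-+ {λ n → seq x n ℚ.- seq x′ n} {λ n → seq y n ℚ.- seq y′ n} p q))
  where
  lemma : ∀ s s′ t t′ → (s ℚ.+ t) ℚ.- (s′ ℚ.+ t′) ≡ (s ℚ.- s′) ℚ.+ (t ℚ.- t′)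
  lemma = solve 4 (λ s s′ t t′ → (s :+ t) :- (s′ :+ t′) := (s :- s′) :+ (t :- t′)) refl
    where open ℚ-Solver

-‿cong : x ≈ y → - x ≈ - y
-‿cong {x} {y} (wrap p) = wrap (null-cong (λ n → lemma (seq x n) (seq y n))
    (null-neg {λ n → seq x n ℚ.- seq y n} p))
  where
  lemma : ∀ s t → (ℚ.- s) ℚ.- (ℚ.- t) ≡ ℚ.- (s ℚ.- t)
  lemma = solve 2 (λ s t → (:- s) :- (:- t) := :- (s :- t)) refl
    where open ℚ-Solver

*-cong : x ≈ x′ → y ≈ y′ → x * y ≈ x′ * y′
*-cong {x} {x′} {y} {y′} (wrap p) (wrap q) = wrap
  (null-cong (λ n → lemma (seq x n) (seq x′ n) (seq y n) (seq y′ n))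
    (null-+ {λ n → seq x n ℚ.* (seq y n ℚ.- seq y′ n)} {λ n → seq y′ n ℚ.* (seq x n ℚ.- seq x′ n)}
      (null-* {seq x} {λ n → seq y n ℚ.- seq y′ n} (cauchy-bounded x) q)
      (null-* {seq y′} {λ n → seq x n ℚ.- seq x′ n} (cauchy-bounded y′) p)))
  where
  lemma : ∀ s s′ t t′ → (s ℚ.* t) ℚ.- (s′ ℚ.* t′) ≡ s ℚ.* (t ℚ.- t′) ℚ.+ t′ ℚ.* (s ℚ.- s′)
  lemma = solve 4 (λ s s′ t t′ →
    (s :* t) :- (s′ :* t′) := s :* (t :- t′) :+ t′ :* (s :- s′)) refl
    where open ℚ-Solver

p≤∣p∣ : ∀ p → p ℚ.≤ ∣ p ∣
p≤∣p∣ p with ℚ.≤-total 0ℚ p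
... | inj₁ 0≤p = ℚ.≤-reflexive (sym (ℚ.0≤p⇒∣p∣≡p 0≤p))
... | inj₂ p≤0 = ℚ.≤-trans p≤0 (ℚ.0≤∣p∣ p)

≈-setoid : Setoid _ _
≈-setoid = record
  { Carrier = ℝ ; _≈_ = _≈_
  ; isEquivalence = record { refl = ≈-refl ; sym = ≈-sym ; trans = ≈-trans } }

module ≈-Reasoning = SetoidReasoning ≈-setoid

-- Positive reals

infix 4 0<_
0<_ : (ℕ → ℚ) → Set
0< z = ∃[ ε ] (0ℚ ℚ.< ε × Eventually (λ n → ε ℚ.< z n))

<⇒0< : 0ℝ < x → 0< seq x
<⇒0< {x} (ε , 0<ε , p) =
  ε , 0<ε , eventually-map (λ n → subst (ℚ._< seq x n) (ℚ.+-identityˡ ε)) p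

0<⇒< : 0< seq x → 0ℝ < x
0<⇒< {x} (ε , 0<ε , p) =
  ε , 0<ε , eventually-map (λ n → subst (ℚ._< seq x n) (sym (ℚ.+-identityˡ ε))) p

pos-resp-≈ : x ≈ y → 0ℝ < x → 0ℝ < y
pos-resp-≈ {x} {y} (wrap x≃y) 0<x with <⇒0< {x} 0<x
... | ε , 0<ε , p = 0<⇒< {y} (ε ℚ.* ½ , *-pos 0<ε 0<½
    , eventually-∩ (λ n → step (seq x n) (seq y n)) p (x≃y (ε ℚ.* ½) (*-pos 0<ε 0<½)))
  where
  open ℚ.≤-Reasoning
  step : ∀ s t → ε ℚ.< s → ∣ s ℚ.- t ∣ ℚ.< ε ℚ.* ½ → ε ℚ.* ½ ℚ.< t
  step s t p q = begin-strict
    ε ℚ.* ½                        ≡⟨ solve 2 (λ e h → e :* h := (e :* h :+ e :* h) :- e :* h) refl ε ½ ⟩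
    (ε ℚ.* ½ ℚ.+ ε ℚ.* ½) ℚ.- ε ℚ.* ½ ≡⟨ cong (ℚ._- ε ℚ.* ½) (half+half ε) ⟩
    ε ℚ.- ε ℚ.* ½                  <⟨ ℚ.+-mono-<-≤ p (ℚ.neg-antimono-≤ (ℚ.≤-trans (p≤∣p∣ (s ℚ.- t)) (ℚ.<⇒≤ q))) ⟩
    s ℚ.- (s ℚ.- t)                ≡⟨ solve 2 (λ s t → s :- (s :- t) := t) refl s t ⟩
    t                              ∎
    where open ℚ-Solver

pos-+ : 0ℝ < x → 0ℝ < y → 0ℝ < x + y
pos-+ {x} {y} 0<x 0<y with <⇒0< {x} 0<x | <⇒0< {y} 0<y
... | ε , 0<ε , p | η , 0<η , q =
  0<⇒< {x + y} (ε ℚ.+ η , ℚ.+-mono-< 0<ε 0<η , eventually-∩ (λ _ → ℚ.+-mono-<) p q)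

pos-* : 0ℝ < x → 0ℝ < y → 0ℝ < x * y
pos-* {x} {y} 0<x 0<y with <⇒0< {x} 0<x | <⇒0< {y} 0<y
... | ε , 0<ε , p | η , 0<η , q =
  0<⇒< {x * y} (ε ℚ.* η , *-pos 0<ε 0<η , eventually-∩ step p q)
  where
  step : ∀ n → ε ℚ.< seq x n → η ℚ.< seq y n → ε ℚ.* η ℚ.< seq x n ℚ.* seq y n
  step n h k = ℚ.<-trans (ℚ.*-monoʳ-<-pos ε {{ℚ.positive 0<ε}} k)
    (ℚ.*-monoˡ-<-pos (seq y n) {{ℚ.positive (ℚ.<-trans 0<η k)}} h)

square≥0 : ∀ p → 0ℚ ℚ.≤ p ℚ.* p
square≥0 p with ℚ.≤-total 0ℚ p
... | inj₁ 0≤p = subst (ℚ._≤ p ℚ.* p) (ℚ.*-zeroˡ p)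
  (ℚ.*-monoʳ-≤-nonNeg p {{ℚ.nonNegative 0≤p}} 0≤p)
... | inj₂ p≤0 = subst (ℚ._≤ p ℚ.* p) (ℚ.*-zeroˡ p)
  (ℚ.*-monoʳ-≤-nonPos p {{ℚ.nonPositive p≤0}} p≤0)

private
  1-d<st : ∀ d s t → ∣ s ℚ.* t ℚ.- 1ℚ ∣ ℚ.< d → 1ℚ ℚ.- d ℚ.< ∣ s ∣ ℚ.* ∣ t ∣
  1-d<st d s t st≈1 = begin-strict
    1ℚ ℚ.- d                        <⟨ ℚ.+-monoʳ-< 1ℚ (ℚ.neg-antimono-< (ℚ.≤-<-trans (p≤∣p∣ _) st≈1′)) ⟩
    1ℚ ℚ.- (ℚ.- (s ℚ.* t ℚ.- 1ℚ))   ≡⟨ cancel 1ℚ (s ℚ.* t) ⟩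
    s ℚ.* t                         ≤⟨ p≤∣p∣ (s ℚ.* t) ⟩
    ∣ s ℚ.* t ∣                     ≡⟨ ℚ.∣p*q∣≡∣p∣*∣q∣ s t ⟩
    ∣ s ∣ ℚ.* ∣ t ∣                 ∎
    where
    open ℚ.≤-Reasoning
    open ℚ-Solver
    st≈1′ : ∣ ℚ.- (s ℚ.* t ℚ.- 1ℚ) ∣ ℚ.< d
    st≈1′ = subst (ℚ._< d) (sym (ℚ.∣-p∣≡∣p∣ (s ℚ.* t ℚ.- 1ℚ))) st≈1
    cancel : ∀ p q → p ℚ.- (ℚ.- (q ℚ.- p)) ≡ q
    cancel = solve 2 (λ p q → p :- (:- (q :- p)) := q) refl

  square-bound : ∀ {B C} e s t → 0ℚ ℚ.< C → 0ℚ ℚ.< e → B ℚ.* C ≡ 1ℚ →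
    ∣ t ∣ ℚ.≤ B → e ℚ.< ∣ s ∣ ℚ.* ∣ t ∣ → C ℚ.* e ℚ.* (C ℚ.* e) ℚ.< s ℚ.* s
  square-bound {B} {C} e s t 0<C 0<e BC≡1 t≤B e<st = begin-strict
    C ℚ.* e ℚ.* (C ℚ.* e)  <⟨ ℚ.*-monoʳ-<-pos (C ℚ.* e) {{ℚ.positive (*-pos 0<C 0<e)}} Ce<∣s∣ ⟩
    C ℚ.* e ℚ.* ∣ s ∣      ≤⟨ ℚ.*-monoʳ-≤-nonNeg ∣ s ∣ {{ℚ.∣-∣-nonNeg s}} (ℚ.<⇒≤ Ce<∣s∣) ⟩
    ∣ s ∣ ℚ.* ∣ s ∣        ≡⟨ sym (ℚ.∣p*q∣≡∣p∣*∣q∣ s s) ⟩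
    ∣ s ℚ.* s ∣            ≡⟨ ℚ.0≤p⇒∣p∣≡p (square≥0 s) ⟩
    s ℚ.* s                ∎
    where
    open ℚ.≤-Reasoning
    open ℚ-Solver
    swap : ∀ c b s → c ℚ.* (s ℚ.* b) ≡ b ℚ.* c ℚ.* s
    swap = solve 3 (λ c b s → c :* (s :* b) := b :* c :* s) refl
    Ce<∣s∣ : C ℚ.* e ℚ.< ∣ s ∣
    Ce<∣s∣ = begin-strict
      C ℚ.* e                  <⟨ ℚ.*-monoʳ-<-pos C {{ℚ.positive 0<C}} e<st ⟩
      C ℚ.* (∣ s ∣ ℚ.* ∣ t ∣)  ≤⟨ ℚ.*-monoˡ-≤-nonNeg C {{ℚ.pos⇒nonNeg C {{ℚ.positive 0<C}}}}
                                    (ℚ.*-monoˡ-≤-nonNeg ∣ s ∣ {{ℚ.∣-∣-nonNeg s}} t≤B) ⟩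
      C ℚ.* (∣ s ∣ ℚ.* B)      ≡⟨ swap C B ∣ s ∣ ⟩
      B ℚ.* C ℚ.* ∣ s ∣        ≡⟨ cong (ℚ._* ∣ s ∣) BC≡1 ⟩
      1ℚ ℚ.* ∣ s ∣             ≡⟨ ℚ.*-identityˡ ∣ s ∣ ⟩
      ∣ s ∣                    ∎

  unit-square : ∀ d e (z w : ℕ → ℚ) → 0ℚ ℚ.< e → 1ℚ ℚ.- d ≡ e → Bounded w →
    Eventually (λ n → ∣ z n ℚ.* w n ℚ.- 1ℚ ∣ ℚ.< d) → 0< λ n → z n ℚ.* z n
  unit-square d e z w 0<e 1-d≡e (B , 0<B , w≤B) zw≈1 with recip 0<B
  ... | C , 0<C , BC≡1 = C ℚ.* e ℚ.* (C ℚ.* e) , *-pos (*-pos 0<C 0<e) (*-pos 0<C 0<e)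
      , eventually-∩ (λ n p q → square-bound e (z n) (w n) 0<C 0<e BC≡1 p
          (subst (ℚ._< ∣ z n ∣ ℚ.* ∣ w n ∣) 1-d≡e (1-d<st d (z n) (w n) q))) w≤B zw≈1

-- If |y| ≤ B and C = 1/B, then |xy - 1| < ½ forces |x| > C/2, so C²/4 is eventually a lower bound
-- for x². The sign of x is never decided.
unit-square-pos : x * y ≈ 1ℝ → 0ℝ < x * x
unit-square-pos {x} {y} (wrap xy≃1) = 0<⇒< {x * x}
  (unit-square ½ ½ (seq x) (seq y) 0<½ refl (cauchy-bounded y) (xy≃1 ½ 0<½))

-- The expression is (x + ½)² + ¾, and the witness ½ lies strictly below ¾ at every index.
1+x+x²-pos : ∀ x → 0ℝ < 1ℝ + x + x * x
1+x+x²-pos x = 0<⇒< {1ℝ + x + x * x} (½ , 0<½ , 0 , λ n _ → step (seq x n))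
  where
  open ℚ.≤-Reasoning
  open ℚ-Solver
  step : ∀ s → ½ ℚ.< 1ℚ ℚ.+ s ℚ.+ s ℚ.* s
  step s = begin-strict
    ½                                          ≡⟨ ℚ.+-identityʳ ½ ⟨
    ½ ℚ.+ 0ℚ                                   <⟨ ℚ.+-monoʳ-< ½ (ℚ.+-mono-<-≤ (*-pos 0<½ 0<½) (square≥0 (s ℚ.+ ½))) ⟩
    ½ ℚ.+ (½ ℚ.* ½ ℚ.+ (s ℚ.+ ½) ℚ.* (s ℚ.+ ½)) ≡⟨ solve 1 (λ s →
      con ½ :+ (con ½ :* con ½ :+ (s :+ con ½) :* (s :+ con ½)) := con 1ℚ :+ s :+ s :* s) refl s ⟩
    1ℚ ℚ.+ s ℚ.+ s ℚ.* s                       ∎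

fromℚ-pos : ∀ {p} → 0ℝ < fromℚ p → 0ℚ ℚ.< p
fromℚ-pos {p} 0<p with <⇒0< {fromℚ p} 0<p
... | ε , 0<ε , N , ε<p = ℚ.<-trans 0<ε (ε<p N ℕ.≤-refl)

-- If p and q differed, |p - q| would itself be an admissible ε, and constant sequences never come
-- closer than that.
fromℚ-injective : ∀ {p q} → fromℚ p ≈ fromℚ q → p ≡ q
fromℚ-injective {p} {q} (wrap p≃q) with ℚ.<-cmp 0ℚ ∣ p ℚ.- q ∣
... | tri< 0<d _ _ with p≃q _ 0<d
... | N , d<d = contradiction (d<d N ℕ.≤-refl) (ℚ.<-irrefl refl)
fromℚ-injective {p} {q} (wrap p≃q) | tri≈ _ 0≡d _ =
  trans (solve 2 (λ p q → p := (p :- q) :+ q) refl p q)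
    (trans (cong (ℚ._+ q) (ℚ.∣p∣≡0⇒p≡0 (p ℚ.- q) (sym 0≡d))) (ℚ.+-identityˡ q))
  where open ℚ-Solver
fromℚ-injective {p} {q} (wrap p≃q) | tri> _ _ d<0 =
  contradiction (ℚ.<-≤-trans d<0 (ℚ.0≤∣p∣ (p ℚ.- q))) (ℚ.<-irrefl refl)

-- The integers inside the rationals

ι : ℤ → ℚ
ι z = z / 1

-- `z / 1` is normalised and does not reduce for a variable `z`; the laws of `ι` are therefore
-- checked on unnormalised fractions with denominator 1.
toℚᵘ-ι : ∀ z → ℚ.toℚᵘ (ι z) ℚᵘ.≃ ℚᵘ.mkℚᵘ z 0
toℚᵘ-ι z = ℚ.toℚᵘ-fromℚᵘ (ℚᵘ.mkℚᵘ z 0)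

ι-+ : ∀ x y → ι (x ℤ.+ y) ≡ ι x ℚ.+ ι y
ι-+ x y = ℚ.toℚᵘ-injective (begin
  ℚ.toℚᵘ (ι (x ℤ.+ y))                  ≈⟨ toℚᵘ-ι (x ℤ.+ y) ⟩
  ℚᵘ.mkℚᵘ (x ℤ.+ y) 0                   ≈⟨ ℚᵘ.*≡* (cong (ℤ._* 1ℤ) (sym (cong₂ ℤ._+_ (ℤ.*-identityʳ x) (ℤ.*-identityʳ y)))) ⟩
  ℚᵘ.mkℚᵘ x 0 ℚᵘ.+ ℚᵘ.mkℚᵘ y 0          ≈⟨ ℚᵘ.+-cong (toℚᵘ-ι x) (toℚᵘ-ι y) ⟨
  ℚ.toℚᵘ (ι x) ℚᵘ.+ ℚ.toℚᵘ (ι y)        ≈⟨ ℚ.toℚᵘ-homo-+ (ι x) (ι y) ⟨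
  ℚ.toℚᵘ (ι x ℚ.+ ι y)                  ∎)
  where open ℚᵘ.≃-Reasoning

ι-* : ∀ x y → ι (x ℤ.* y) ≡ ι x ℚ.* ι y
ι-* x y = ℚ.toℚᵘ-injective (begin
  ℚ.toℚᵘ (ι (x ℤ.* y))                  ≈⟨ toℚᵘ-ι (x ℤ.* y) ⟩
  ℚᵘ.mkℚᵘ x 0 ℚᵘ.* ℚᵘ.mkℚᵘ y 0          ≈⟨ ℚᵘ.*-cong (toℚᵘ-ι x) (toℚᵘ-ι y) ⟨
  ℚ.toℚᵘ (ι x) ℚᵘ.* ℚ.toℚᵘ (ι y)        ≈⟨ ℚ.toℚᵘ-homo-* (ι x) (ι y) ⟨
  ℚ.toℚᵘ (ι x ℚ.* ι y)                  ∎)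
  where open ℚᵘ.≃-Reasoning

ι-neg : ∀ x → ι (ℤ.- x) ≡ ℚ.- ι x
ι-neg x = ℚ.toℚᵘ-injective (begin
  ℚ.toℚᵘ (ι (ℤ.- x))     ≈⟨ toℚᵘ-ι (ℤ.- x) ⟩
  ℚᵘ.- ℚᵘ.mkℚᵘ x 0       ≈⟨ ℚᵘ.-‿cong (toℚᵘ-ι x) ⟨
  ℚᵘ.- ℚ.toℚᵘ (ι x)      ≈⟨ ℚ.toℚᵘ-homo‿- (ι x) ⟨
  ℚ.toℚᵘ (ℚ.- ι x)       ∎)
  where open ℚᵘ.≃-Reasoning

ι-injective : ∀ {x y} → ι x ≡ ι y → x ≡ y
ι-injective {x} {y} eq =
  trans (sym (ℤ.*-identityʳ x)) (trans (ℚᵘ.drop-*≡* (ℚᵘ.≃-trans (ℚᵘ.≃-sym (toℚᵘ-ι x))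
    (ℚᵘ.≃-trans (ℚᵘ.≃-reflexive (cong ℚ.toℚᵘ eq)) (toℚᵘ-ι y)))) (ℤ.*-identityʳ y))

ι-cancel-≤ : ∀ {x y} → ι x ℚ.≤ ι y → x ℤ.≤ y
ι-cancel-≤ {x} {y} le =
  subst₂ ℤ._≤_ (ℤ.*-identityʳ x) (ℤ.*-identityʳ y) (ℚᵘ.drop-*≤* (ℚᵘ.≤-trans
    (ℚᵘ.≤-reflexive (ℚᵘ.≃-sym (toℚᵘ-ι x))) (ℚᵘ.≤-trans (ℚ.toℚᵘ-mono-≤ le) (ℚᵘ.≤-reflexive (toℚᵘ-ι y)))))

ι-mono-≤ : ∀ {x y} → x ℤ.≤ y → ι x ℚ.≤ ι y
ι-mono-≤ {x} {y} le = ℚ.toℚᵘ-cancel-≤ (ℚᵘ.≤-trans (ℚᵘ.≤-reflexive (toℚᵘ-ι x))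
  (ℚᵘ.≤-trans (ℚᵘ.*≤* (subst₂ ℤ._≤_ (sym (ℤ.*-identityʳ x)) (sym (ℤ.*-identityʳ y)) le))
    (ℚᵘ.≤-reflexive (ℚᵘ.≃-sym (toℚᵘ-ι y)))))

ι-cancel-< : ∀ {x y} → ι x ℚ.< ι y → x ℤ.< y
ι-cancel-< {x} {y} lt = ℤ.≰⇒> λ y≤x → ℚ.<-irrefl refl (ℚ.<-≤-trans lt (ι-mono-≤ y≤x))

ι-mono-< : ∀ {x y} → x ℤ.< y → ι x ℚ.< ι y
ι-mono-< {x} {y} lt = ℚ.≰⇒> λ y≤x → ℤ.<-irrefl refl (ℤ.<-≤-trans lt (ι-cancel-≤ y≤x))

-- The norm form and its anisotropy

-- The norm of x + yρ + zρ² with b = a + 3, as a determinant.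
normForm : (R : RawRing 0ℓ 0ℓ) (a b x y z : RawRing.Carrier R) → RawRing.Carrier R
normForm R a b x y z =
    (p₁ ⊠ q₂ ⊞ ⊟ (q₁ ⊠ p₂)) ⊠ x ⊞ (q₁ ⊠ z ⊞ ⊟ (y ⊠ q₂)) ⊠ z ⊞ (y ⊠ p₂ ⊞ ⊟ (p₁ ⊠ z)) ⊠ p₂
  where
  open RawRing R using () renaming (_+_ to _⊞_; _*_ to _⊠_; -_ to ⊟_)
  p₁ = x ⊞ b ⊠ z
  p₂ = y ⊞ a ⊠ z
  q₁ = z ⊞ b ⊠ p₂
  q₂ = p₁ ⊞ a ⊠ p₂

module _ (X Y : RawRing 0ℓ 0ℓ) where
  private
    module X = RawRing X
    module Y = RawRing Y
  -- Used both for `parity` (reduction modulo 2) and for `ι`; this is why `normForm` is written over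
  -- a raw ring.
  normForm-homo : (h : X.Carrier → Y.Carrier) →
    (∀ x y → h (x X.+ y) ≡ h x Y.+ h y) → (∀ x y → h (x X.* y) ≡ h x Y.* h y) →
    (∀ x → h (X.- x) ≡ Y.- h x) →
    ∀ a b x y z → h (normForm X a b x y z) ≡ normForm Y (h a) (h b) (h x) (h y) (h z)
  normForm-homo h h+ h* h- a b x y z =
    +ᵉ (+ᵉ (*ᵉ (-ᵉ (*ᵉ p₁ q₂) (*ᵉ q₁ p₂)) refl) (*ᵉ (-ᵉ (*ᵉ q₁ refl) (*ᵉ refl q₂)) refl))
       (*ᵉ (-ᵉ (*ᵉ refl p₂) (*ᵉ p₁ refl)) p₂)
    where
    +ᵉ : ∀ {s t s′ t′} → h s ≡ s′ → h t ≡ t′ → h (s X.+ t) ≡ s′ Y.+ t′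
    +ᵉ p q = trans (h+ _ _) (cong₂ Y._+_ p q)
    *ᵉ : ∀ {s t s′ t′} → h s ≡ s′ → h t ≡ t′ → h (s X.* t) ≡ s′ Y.* t′
    *ᵉ p q = trans (h* _ _) (cong₂ Y._*_ p q)
    -ᵉ : ∀ {s t s′ t′} → h s ≡ s′ → h t ≡ t′ → h (s X.+ X.- t) ≡ s′ Y.+ Y.- t′
    -ᵉ p q = +ᵉ p (trans (h- _) (cong Y.-_ q))
    p₁ = +ᵉ {x} refl (*ᵉ {b} {z} refl refl)
    p₂ = +ᵉ {y} refl (*ᵉ {a} {z} refl refl)
    q₁ = +ᵉ {z} refl (*ᵉ {b} refl p₂)
    q₂ = +ᵉ p₁ (*ᵉ {a} refl p₂)

-- Reduction modulo 2

ℙ-rawRing : RawRing 0ℓ 0ℓ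
ℙ-rawRing = record
  { Carrier = Parity ; _≈_ = _≡_
  ; _+_ = ℙ._+_ ; _*_ = ℙ._*_ ; -_ = λ p → p ; 0# = 0ℙ ; 1# = 1ℙ }

parity : ℤ → Parity
parity z = ℕ.parity ℤ.∣ z ∣

private
  suc-parity : ∀ n → ℕ.parity (suc n) ≡ 1ℙ ℙ.+ ℕ.parity n
  suc-parity n = ℙ.+-homo-+ 1 n

  cancel-1ℙ : ∀ p q → p ℙ.+ q ≡ (1ℙ ℙ.+ p) ℙ.+ (1ℙ ℙ.+ q)
  cancel-1ℙ 0ℙ 0ℙ = refl
  cancel-1ℙ 0ℙ 1ℙ = refl
  cancel-1ℙ 1ℙ 0ℙ = refl
  cancel-1ℙ 1ℙ 1ℙ = refl

  parity-⊖ : ∀ m n → parity (m ℤ.⊖ n) ≡ ℕ.parity m ℙ.+ ℕ.parity n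
  parity-⊖ zero zero = refl
  parity-⊖ zero (suc n) = refl
  parity-⊖ (suc m) zero = sym (ℙ.+-identityʳ (ℕ.parity (suc m)))
  parity-⊖ (suc m) (suc n) = begin
    parity (suc m ℤ.⊖ suc n)                       ≡⟨ cong parity (ℤ.[1+m]⊖[1+n]≡m⊖n m n) ⟩
    parity (m ℤ.⊖ n)                               ≡⟨ parity-⊖ m n ⟩
    ℕ.parity m ℙ.+ ℕ.parity n                      ≡⟨ cancel-1ℙ (ℕ.parity m) (ℕ.parity n) ⟩
    (1ℙ ℙ.+ ℕ.parity m) ℙ.+ (1ℙ ℙ.+ ℕ.parity n)    ≡⟨ cong₂ ℙ._+_ (suc-parity m) (suc-parity n) ⟨
    ℕ.parity (suc m) ℙ.+ ℕ.parity (suc n)          ∎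
    where open ≡-Reasoning

parity-+ : ∀ x y → parity (x ℤ.+ y) ≡ parity x ℙ.+ parity y
parity-+ (ℤ.+ m) (ℤ.+ n) = ℙ.+-homo-+ m n
parity-+ (ℤ.+ m) ℤ.-[1+ n ] = parity-⊖ m (suc n)
parity-+ ℤ.-[1+ m ] (ℤ.+ n) = trans (parity-⊖ n (suc m)) (ℙ.+-comm (ℕ.parity n) (ℕ.parity (suc m)))
parity-+ ℤ.-[1+ m ] ℤ.-[1+ n ] =
  trans (cong ℕ.parity (cong suc (sym (ℕ.+-suc m n)))) (ℙ.+-homo-+ (suc m) (suc n))

parity-* : ∀ x y → parity (x ℤ.* y) ≡ parity x ℙ.* parity y
parity-* x y = trans (cong ℕ.parity (ℤ.abs-* x y)) (ℙ.*-homo-* ℤ.∣ x ∣ ℤ.∣ y ∣)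

parity-neg : ∀ x → parity (ℤ.- x) ≡ parity x
parity-neg x = cong ℕ.parity (ℤ.∣-i∣≡∣i∣ x)

private
  halve-ℕ : ∀ n → ℕ.parity n ≡ 0ℙ → ∃[ k ] n ≡ k ℕ.+ k
  halve-ℕ zero _ = 0 , refl
  halve-ℕ (suc (suc n)) p with halve-ℕ n p
  ... | k , refl = suc k , cong suc (sym (ℕ.+-suc k k))

  2*i≡i+i : ∀ i → ℤ.+ 2 ℤ.* i ≡ i ℤ.+ i
  2*i≡i+i i = trans (ℤ.*-distribʳ-+ i ℤ.1ℤ ℤ.1ℤ) (cong₂ ℤ._+_ (ℤ.*-identityˡ i) (ℤ.*-identityˡ i))

-- The equation between absolute values is what lets the size decrease in the descent.
halve : ∀ z → parity z ≡ 0ℙ → ∃[ w ] (z ≡ ℤ.+ 2 ℤ.* w × ℤ.∣ z ∣ ≡ ℤ.∣ w ∣ ℕ.+ ℤ.∣ w ∣)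
halve (ℤ.+ n) p with halve-ℕ n p
... | k , refl = ℤ.+ k , sym (2*i≡i+i (ℤ.+ k)) , refl
halve ℤ.-[1+ n ] p with halve-ℕ (suc n) p
... | k , eq = ℤ.- (ℤ.+ k)
  , trans (cong (λ m → ℤ.- (ℤ.+ m)) eq) (trans (ℤ.neg-distrib-+ (ℤ.+ k) (ℤ.+ k)) (sym (2*i≡i+i (ℤ.- (ℤ.+ k)))))
  , trans eq (sym (cong₂ ℕ._+_ (ℤ.∣-i∣≡∣i∣ (ℤ.+ k)) (ℤ.∣-i∣≡∣i∣ (ℤ.+ k))))

-- The cubic is irreducible modulo 2.
normForm-ℙ-anisotropic : ∀ a x y z → normForm ℙ-rawRing a (a ℙ.+ 1ℙ) x y z ≡ 0ℙ →
  x ≡ 0ℙ × y ≡ 0ℙ × z ≡ 0ℙ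
normForm-ℙ-anisotropic a  0ℙ 0ℙ 0ℙ _ = refl , refl , refl
normForm-ℙ-anisotropic 0ℙ 0ℙ 0ℙ 1ℙ ()
normForm-ℙ-anisotropic 0ℙ 0ℙ 1ℙ 0ℙ ()
normForm-ℙ-anisotropic 0ℙ 0ℙ 1ℙ 1ℙ ()
normForm-ℙ-anisotropic 0ℙ 1ℙ 0ℙ 0ℙ ()
normForm-ℙ-anisotropic 0ℙ 1ℙ 0ℙ 1ℙ ()
normForm-ℙ-anisotropic 0ℙ 1ℙ 1ℙ 0ℙ ()
normForm-ℙ-anisotropic 0ℙ 1ℙ 1ℙ 1ℙ ()
normForm-ℙ-anisotropic 1ℙ 0ℙ 0ℙ 1ℙ ()
normForm-ℙ-anisotropic 1ℙ 0ℙ 1ℙ 0ℙ ()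
normForm-ℙ-anisotropic 1ℙ 0ℙ 1ℙ 1ℙ ()
normForm-ℙ-anisotropic 1ℙ 1ℙ 0ℙ 0ℙ ()
normForm-ℙ-anisotropic 1ℙ 1ℙ 0ℙ 1ℙ ()
normForm-ℙ-anisotropic 1ℙ 1ℙ 1ℙ 0ℙ ()
normForm-ℙ-anisotropic 1ℙ 1ℙ 1ℙ 1ℙ ()

normForm-even : ∀ a x y z → normForm ℤ.+-*-rawRing a (a ℤ.+ ℤ.+ 3) x y z ≡ 0ℤ →
  parity x ≡ 0ℙ × parity y ≡ 0ℙ × parity z ≡ 0ℙ
normForm-even a x y z N≡0 = normForm-ℙ-anisotropic (parity a) (parity x) (parity y) (parity z) (begin
  normForm ℙ-rawRing (parity a) (parity a ℙ.+ 1ℙ) (parity x) (parity y) (parity z)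
    ≡⟨ cong (λ b → normForm ℙ-rawRing (parity a) b (parity x) (parity y) (parity z)) (parity-+ a (ℤ.+ 3)) ⟨
  normForm ℙ-rawRing (parity a) (parity (a ℤ.+ ℤ.+ 3)) (parity x) (parity y) (parity z)
    ≡⟨ normForm-homo ℤ.+-*-rawRing ℙ-rawRing parity parity-+ parity-* parity-neg a (a ℤ.+ ℤ.+ 3) x y z ⟨
  parity (normForm ℤ.+-*-rawRing a (a ℤ.+ ℤ.+ 3) x y z)
    ≡⟨ cong parity N≡0 ⟩
  0ℙ ∎)
  where open ≡-Reasoning

-- Homogeneity of the norm form and infinite descent

private
  -- The derived entries are linear in x, y, z, so they scale by s as well. Taking them as
  -- independent variables spares the solver the fully expanded norm form.
  det-scale : ∀ s x y z p₁ p₂ q₁ q₂ →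
    (s ℚ.* p₁ ℚ.* (s ℚ.* q₂) ℚ.- s ℚ.* q₁ ℚ.* (s ℚ.* p₂)) ℚ.* (s ℚ.* x)
      ℚ.+ (s ℚ.* q₁ ℚ.* (s ℚ.* z) ℚ.- s ℚ.* y ℚ.* (s ℚ.* q₂)) ℚ.* (s ℚ.* z)
      ℚ.+ (s ℚ.* y ℚ.* (s ℚ.* p₂) ℚ.- s ℚ.* p₁ ℚ.* (s ℚ.* z)) ℚ.* (s ℚ.* p₂) ≡
    s ℚ.* s ℚ.* s ℚ.* ((p₁ ℚ.* q₂ ℚ.- q₁ ℚ.* p₂) ℚ.* x ℚ.+ (q₁ ℚ.* z ℚ.- y ℚ.* q₂) ℚ.* z
      ℚ.+ (y ℚ.* p₂ ℚ.- p₁ ℚ.* z) ℚ.* p₂)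
  det-scale = solve 8 (λ s x y z p₁ p₂ q₁ q₂ →
    (s :* p₁ :* (s :* q₂) :- s :* q₁ :* (s :* p₂)) :* (s :* x)
      :+ (s :* q₁ :* (s :* z) :- s :* y :* (s :* q₂)) :* (s :* z)
      :+ (s :* y :* (s :* p₂) :- s :* p₁ :* (s :* z)) :* (s :* p₂) :=
    s :* s :* s :* ((p₁ :* q₂ :- q₁ :* p₂) :* x :+ (q₁ :* z :- y :* q₂) :* z
      :+ (y :* p₂ :- p₁ :* z) :* p₂)) refl
    where open ℚ-Solver

  m+m≤1+n⇒m≤n : ∀ {m n} → m ℕ.+ m ℕ.≤ suc n → m ℕ.≤ n
  m+m≤1+n⇒m≤n {zero} _ = z≤n
  m+m≤1+n⇒m≤n {suc m} {n} (s≤s h) = ℕ.≤-trans (ℕ.m≤n+m (suc m) m) h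

  twice-sum : ∀ x y z → (x ℕ.+ x) ℕ.+ (y ℕ.+ y) ℕ.+ (z ℕ.+ z) ≡ (x ℕ.+ y ℕ.+ z) ℕ.+ (x ℕ.+ y ℕ.+ z)
  twice-sum = solve 3 (λ x y z → (x :+ x) :+ (y :+ y) :+ (z :+ z) := (x :+ y :+ z) :+ (x :+ y :+ z)) refl
    where open ℕ-Solver.+-*-Solver

  det : (x y z p₁ p₂ q₁ q₂ : ℚ) → ℚ
  det x y z p₁ p₂ q₁ q₂ = (p₁ ℚ.* q₂ ℚ.- q₁ ℚ.* p₂) ℚ.* x ℚ.+ (q₁ ℚ.* z ℚ.- y ℚ.* q₂) ℚ.* z
    ℚ.+ (y ℚ.* p₂ ℚ.- p₁ ℚ.* z) ℚ.* p₂

normForm-scale : ∀ s a b x y z →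
  normForm ℚ.+-*-rawRing a b (s ℚ.* x) (s ℚ.* y) (s ℚ.* z) ≡
  s ℚ.* s ℚ.* s ℚ.* normForm ℚ.+-*-rawRing a b x y z
normForm-scale s a b x y z = begin
  det (s ℚ.* x) (s ℚ.* y) (s ℚ.* z) P₁ P₂ Q₁ Q₂
    ≡⟨ cong₂ (λ f q → f q) (cong₂ (λ f q → f q) (cong₂ (det (s ℚ.* x) (s ℚ.* y) (s ℚ.* z)) P₁≡ P₂≡) Q₁≡) Q₂≡ ⟩
  det (s ℚ.* x) (s ℚ.* y) (s ℚ.* z) (s ℚ.* p₁) (s ℚ.* p₂) (s ℚ.* q₁) (s ℚ.* q₂)
    ≡⟨ det-scale s x y z p₁ p₂ q₁ q₂ ⟩
  s ℚ.* s ℚ.* s ℚ.* det x y z p₁ p₂ q₁ q₂ ∎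
  where
  open ≡-Reasoning
  scale-step : ∀ s b x z → s ℚ.* x ℚ.+ b ℚ.* (s ℚ.* z) ≡ s ℚ.* (x ℚ.+ b ℚ.* z)
  scale-step = solve 4 (λ s b x z → s :* x :+ b :* (s :* z) := s :* (x :+ b :* z)) refl
    where open ℚ-Solver
  p₁ p₂ q₁ q₂ P₁ P₂ Q₁ Q₂ : ℚ
  p₁ = x ℚ.+ b ℚ.* z
  p₂ = y ℚ.+ a ℚ.* z
  q₁ = z ℚ.+ b ℚ.* p₂
  q₂ = p₁ ℚ.+ a ℚ.* p₂
  P₁ = s ℚ.* x ℚ.+ b ℚ.* (s ℚ.* z)
  P₂ = s ℚ.* y ℚ.+ a ℚ.* (s ℚ.* z)
  Q₁ = s ℚ.* z ℚ.+ b ℚ.* P₂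
  Q₂ = P₁ ℚ.+ a ℚ.* P₂
  P₁≡ : P₁ ≡ s ℚ.* p₁
  P₁≡ = scale-step s b x z
  P₂≡ : P₂ ≡ s ℚ.* p₂
  P₂≡ = scale-step s a y z
  Q₁≡ : Q₁ ≡ s ℚ.* q₁
  Q₁≡ = trans (cong (λ t → s ℚ.* z ℚ.+ b ℚ.* t) P₂≡) (scale-step s b z p₂)
  Q₂≡ : Q₂ ≡ s ℚ.* q₂
  Q₂≡ = trans (cong₂ (λ t u → t ℚ.+ a ℚ.* u) P₁≡ P₂≡) (scale-step s a p₁ p₂)

pos*≡0⇒≡0 : ∀ {s} p → 0ℚ ℚ.< s → s ℚ.* p ≡ 0ℚ → p ≡ 0ℚ
pos*≡0⇒≡0 {s} p 0<s sp≡0 with recip 0<s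
... | c , _ , sc≡1 = begin
  p                ≡⟨ ℚ.*-identityˡ p ⟨
  1ℚ ℚ.* p         ≡⟨ cong (ℚ._* p) sc≡1 ⟨
  s ℚ.* c ℚ.* p    ≡⟨ solve 3 (λ s c p → s :* c :* p := c :* (s :* p)) refl s c p ⟩
  c ℚ.* (s ℚ.* p)  ≡⟨ cong (c ℚ.*_) sp≡0 ⟩
  c ℚ.* 0ℚ         ≡⟨ ℚ.*-zeroʳ c ⟩
  0ℚ               ∎
  where open ≡-Reasoning
        open ℚ-Solver

normForm-unscale : ∀ s a b x y z → 0ℚ ℚ.< s →
  normForm ℚ.+-*-rawRing a b (s ℚ.* x) (s ℚ.* y) (s ℚ.* z) ≡ 0ℚ → normForm ℚ.+-*-rawRing a b x y z ≡ 0ℚ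
normForm-unscale s a b x y z 0<s N≡0 = pos*≡0⇒≡0 _ (*-pos (*-pos 0<s 0<s) 0<s)
  (trans (sym (normForm-scale s a b x y z)) N≡0)

normForm-ι : ∀ a b x y z →
  ι (normForm ℤ.+-*-rawRing a b x y z) ≡ normForm ℚ.+-*-rawRing (ι a) (ι b) (ι x) (ι y) (ι z)
normForm-ι = normForm-homo ℤ.+-*-rawRing ℚ.+-*-rawRing ι ι-+ ι-* ι-neg

private
  -- The factor 8 is cancelled in ℚ, where homogeneity is established for an arbitrary scalar.
  normForm-2* : ∀ a b x y z →
    normForm ℤ.+-*-rawRing a b (ℤ.+ 2 ℤ.* x) (ℤ.+ 2 ℤ.* y) (ℤ.+ 2 ℤ.* z) ≡ 0ℤ →
    normForm ℤ.+-*-rawRing a b x y z ≡ 0ℤ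
  normForm-2* a b x y z N≡0 = ι-injective (trans (normForm-ι a b x y z)
    (normForm-unscale (ι (ℤ.+ 2)) (ι a) (ι b) (ι x) (ι y) (ι z) (ℚ.positive⁻¹ (ι (ℤ.+ 2))) (begin
      normForm ℚ.+-*-rawRing (ι a) (ι b) (ι (ℤ.+ 2) ℚ.* ι x) (ι (ℤ.+ 2) ℚ.* ι y) (ι (ℤ.+ 2) ℚ.* ι z)
        ≡⟨ cong₂ (λ f t → f t) (cong₂ (normForm ℚ.+-*-rawRing (ι a) (ι b)) (ι-* (ℤ.+ 2) x) (ι-* (ℤ.+ 2) y)) (ι-* (ℤ.+ 2) z) ⟨
      normForm ℚ.+-*-rawRing (ι a) (ι b) (ι (ℤ.+ 2 ℤ.* x)) (ι (ℤ.+ 2 ℤ.* y)) (ι (ℤ.+ 2 ℤ.* z))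
        ≡⟨ normForm-ι a b (ℤ.+ 2 ℤ.* x) (ℤ.+ 2 ℤ.* y) (ℤ.+ 2 ℤ.* z) ⟨
      ι (normForm ℤ.+-*-rawRing a b (ℤ.+ 2 ℤ.* x) (ℤ.+ 2 ℤ.* y) (ℤ.+ 2 ℤ.* z))
        ≡⟨ cong ι N≡0 ⟩
      0ℚ ∎)))
    where open ≡-Reasoning

  -- A zero of the form has even coordinates by anisotropy modulo 2, and halving them gives a zero
  -- of half the size. The bound n falls by one at each step, since m + m ≤ 1 + n implies m ≤ n.
  descent : ∀ n a x y z → ℤ.∣ x ∣ ℕ.+ ℤ.∣ y ∣ ℕ.+ ℤ.∣ z ∣ ℕ.≤ n →
    normForm ℤ.+-*-rawRing a (a ℤ.+ ℤ.+ 3) x y z ≡ 0ℤ → x ≡ 0ℤ × y ≡ 0ℤ × z ≡ 0ℤ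
  descent zero a x y z h _ =
      ℤ.∣i∣≡0⇒i≡0 (ℕ.m+n≡0⇒m≡0 ℤ.∣ x ∣ x+y≡0)
    , ℤ.∣i∣≡0⇒i≡0 (ℕ.m+n≡0⇒n≡0 ℤ.∣ x ∣ x+y≡0)
    , ℤ.∣i∣≡0⇒i≡0 (ℕ.m+n≡0⇒n≡0 (ℤ.∣ x ∣ ℕ.+ ℤ.∣ y ∣) (ℕ.n≤0⇒n≡0 h))
    where
    x+y≡0 : ℤ.∣ x ∣ ℕ.+ ℤ.∣ y ∣ ≡ 0
    x+y≡0 = ℕ.m+n≡0⇒m≡0 (ℤ.∣ x ∣ ℕ.+ ℤ.∣ y ∣) (ℕ.n≤0⇒n≡0 h)
  descent (suc n) a x y z h N≡0 =
    let ex , ey , ez = normForm-even a x y z N≡0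
        x′ , x≡ , xe = halve x ex
        y′ , y≡ , ye = halve y ey
        z′ , z≡ , ze = halve z ez
        x′≡0 , y′≡0 , z′≡0 = descent n a x′ y′ z′
          (m+m≤1+n⇒m≤n (subst (ℕ._≤ suc n) (trans (cong₂ ℕ._+_ (cong₂ ℕ._+_ xe ye) ze)
            (twice-sum ℤ.∣ x′ ∣ ℤ.∣ y′ ∣ ℤ.∣ z′ ∣)) h))
          (normForm-2* a (a ℤ.+ ℤ.+ 3) x′ y′ z′ (trans (sym (cong₂ (λ f t → f t)
            (cong₂ (normForm ℤ.+-*-rawRing a (a ℤ.+ ℤ.+ 3)) x≡ y≡) z≡)) N≡0))
    in trans x≡ (cong (ℤ.+ 2 ℤ.*_) x′≡0)
     , trans y≡ (cong (ℤ.+ 2 ℤ.*_) y′≡0)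
     , trans z≡ (cong (ℤ.+ 2 ℤ.*_) z′≡0)

normForm-ℤ-anisotropic : ∀ a x y z →
  normForm ℤ.+-*-rawRing a (a ℤ.+ ℤ.+ 3) x y z ≡ 0ℤ → x ≡ 0ℤ × y ≡ 0ℤ × z ≡ 0ℤ
normForm-ℤ-anisotropic a x y z = descent _ a x y z ℕ.≤-refl

numerator-ι : ∀ p → ι (ℚ.↧ p) ℚ.* p ≡ ι (ℚ.↥ p)
numerator-ι p@record{} = ℚ.toℚᵘ-injective (begin
  ℚ.toℚᵘ (ι (ℚ.↧ p) ℚ.* p)               ≈⟨ ℚ.toℚᵘ-homo-* (ι (ℚ.↧ p)) p ⟩
  ℚ.toℚᵘ (ι (ℚ.↧ p)) ℚᵘ.* ℚ.toℚᵘ p       ≈⟨ ℚᵘ.*-congʳ (toℚᵘ-ι (ℚ.↧ p)) ⟩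
  ℚᵘ.mkℚᵘ (ℚ.↧ p) 0 ℚᵘ.* ℚ.toℚᵘ p        ≈⟨ ℚᵘ.*≡* (trans (ℤ.*-identityʳ (ℚ.↧ p ℤ.* ℚ.↥ p))
                                             (trans (ℤ.*-comm (ℚ.↧ p) (ℚ.↥ p)) (cong (λ d → ℚ.↥ p ℤ.* ℤ.+ d) (sym (ℕ.*-identityˡ (ℚ.↧ₙ p)))))) ⟩
  ℚᵘ.mkℚᵘ (ℚ.↥ p) 0                       ≈⟨ toℚᵘ-ι (ℚ.↥ p) ⟨
  ℚ.toℚᵘ (ι (ℚ.↥ p))                     ∎)
  where open ℚᵘ.≃-Reasoning

private
  0<ι↧ : ∀ p → 0ℚ ℚ.< ι (ℚ.↧ p)
  0<ι↧ p = ι-mono-< (ℤ.positive⁻¹ (ℚ.↧ p))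

commonDenominator : ∀ p q r → ∃[ s ] (0ℚ ℚ.< s ×
  ∃[ x ] ∃[ y ] ∃[ z ] (s ℚ.* p ≡ ι x × s ℚ.* q ≡ ι y × s ℚ.* r ≡ ι z))
commonDenominator p q r = d p ℚ.* d q ℚ.* d r , *-pos (*-pos (0<ι↧ p) (0<ι↧ q)) (0<ι↧ r)
  , ℚ.↥ p ℤ.* ℚ.↧ q ℤ.* ℚ.↧ r , ℚ.↥ q ℤ.* ℚ.↧ p ℤ.* ℚ.↧ r , ℚ.↥ r ℤ.* ℚ.↧ p ℤ.* ℚ.↧ q
  , integral p (ℚ.↧ q) (ℚ.↧ r) (move₁ (d p) (d q) (d r) p)
  , integral q (ℚ.↧ p) (ℚ.↧ r) (move₂ (d p) (d q) (d r) q)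
  , integral r (ℚ.↧ p) (ℚ.↧ q) (move₃ (d p) (d q) (d r) r)
  where
  open ≡-Reasoning
  d : ℚ → ℚ
  d t = ι (ℚ.↧ t)
  move₁ : ∀ a b c t → a ℚ.* b ℚ.* c ℚ.* t ≡ a ℚ.* t ℚ.* b ℚ.* c
  move₁ = solve 4 (λ a b c t → a :* b :* c :* t := a :* t :* b :* c) refl
    where open ℚ-Solver
  move₂ : ∀ a b c t → a ℚ.* b ℚ.* c ℚ.* t ≡ b ℚ.* t ℚ.* a ℚ.* c
  move₂ = solve 4 (λ a b c t → a :* b :* c :* t := b :* t :* a :* c) refl
    where open ℚ-Solver
  move₃ : ∀ a b c t → a ℚ.* b ℚ.* c ℚ.* t ≡ c ℚ.* t ℚ.* a ℚ.* b
  move₃ = solve 4 (λ a b c t → a :* b :* c :* t := c :* t :* a :* b) refl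
    where open ℚ-Solver
  integral : ∀ t m n {u} → u ≡ d t ℚ.* t ℚ.* ι m ℚ.* ι n → u ≡ ι (ℚ.↥ t ℤ.* m ℤ.* n)
  integral t m n {u} eq = begin
    u                            ≡⟨ eq ⟩
    d t ℚ.* t ℚ.* ι m ℚ.* ι n    ≡⟨ cong (λ s → s ℚ.* ι m ℚ.* ι n) (numerator-ι t) ⟩
    ι (ℚ.↥ t) ℚ.* ι m ℚ.* ι n    ≡⟨ cong (ℚ._* ι n) (ι-* (ℚ.↥ t) m) ⟨
    ι (ℚ.↥ t ℤ.* m) ℚ.* ι n      ≡⟨ ι-* (ℚ.↥ t ℤ.* m) n ⟨
    ι (ℚ.↥ t ℤ.* m ℤ.* n)        ∎

normForm-ℚ-anisotropic : ∀ a p q r →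
  normForm ℚ.+-*-rawRing (ι a) (ι a ℚ.+ ι (ℤ.+ 3)) p q r ≡ 0ℚ → p ≡ 0ℚ × q ≡ 0ℚ × r ≡ 0ℚ
normForm-ℚ-anisotropic a p q r N≡0 =
  let s , 0<s , x , y , z , sp , sq , sr = commonDenominator p q r
      x≡0 , y≡0 , z≡0 = normForm-ℤ-anisotropic a x y z (ι-injective (begin
        ι (normForm ℤ.+-*-rawRing a (a ℤ.+ ℤ.+ 3) x y z)
          ≡⟨ normForm-ι a (a ℤ.+ ℤ.+ 3) x y z ⟩
        normForm ℚ.+-*-rawRing (ι a) (ι (a ℤ.+ ℤ.+ 3)) (ι x) (ι y) (ι z)
          ≡⟨ cong (λ b → normForm ℚ.+-*-rawRing (ι a) b (ι x) (ι y) (ι z)) (ι-+ a (ℤ.+ 3)) ⟩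
        normForm ℚ.+-*-rawRing (ι a) β (ι x) (ι y) (ι z)
          ≡⟨ cong₂ (λ f t → f t) (cong₂ (normForm ℚ.+-*-rawRing (ι a) β) sp sq) sr ⟨
        normForm ℚ.+-*-rawRing (ι a) β (s ℚ.* p) (s ℚ.* q) (s ℚ.* r)
          ≡⟨ normForm-scale s (ι a) β p q r ⟩
        s ℚ.* s ℚ.* s ℚ.* normForm ℚ.+-*-rawRing (ι a) β p q r
          ≡⟨ cong (s ℚ.* s ℚ.* s ℚ.*_) N≡0 ⟩
        s ℚ.* s ℚ.* s ℚ.* 0ℚ
          ≡⟨ ℚ.*-zeroʳ (s ℚ.* s ℚ.* s) ⟩
        0ℚ ∎))
  in pos*≡0⇒≡0 p 0<s (trans sp (cong ι x≡0))
   , pos*≡0⇒≡0 q 0<s (trans sq (cong ι y≡0))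
   , pos*≡0⇒≡0 r 0<s (trans sr (cong ι z≡0))
  where
  open ≡-Reasoning
  β : ℚ
  β = ι a ℚ.+ ι (ℤ.+ 3)

-- Arithmetic modulo the cubic

-- ⟨ x , y , z ⟩ stands for x + yρ + zρ².
record ℚ³ : Set where
  constructor ⟨_,_,_⟩
  field
    c₀ c₁ c₂ : ℚ

open ℚ³ public

⟨⟩-cong : ∀ {x x′ y y′ z z′} → x ≡ x′ → y ≡ y′ → z ≡ z′ → ⟨ x , y , z ⟩ ≡ ⟨ x′ , y′ , z′ ⟩
⟨⟩-cong refl refl refl = refl

0³ 1³ : ℚ³
0³ = ⟨ 0ℚ , 0ℚ , 0ℚ ⟩
1³ = ⟨ 1ℚ , 0ℚ , 0ℚ ⟩

infixl 6 _⊕_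
_⊕_ : ℚ³ → ℚ³ → ℚ³
⟨ x , y , z ⟩ ⊕ ⟨ x′ , y′ , z′ ⟩ = ⟨ x ℚ.+ x′ , y ℚ.+ y′ , z ℚ.+ z′ ⟩

infixl 7 _∙_
_∙_ : ℚ → ℚ³ → ℚ³
s ∙ ⟨ x , y , z ⟩ = ⟨ s ℚ.* x , s ℚ.* y , s ℚ.* z ⟩

neg³ : ℚ³ → ℚ³
neg³ ⟨ x , y , z ⟩ = ⟨ ℚ.- x , ℚ.- y , ℚ.- z ⟩

lincomb : ℚ³ → ℚ³ → ℚ³ → ℚ³ → ℚ³
lincomb ⟨ p , q , r ⟩ u v w = p ∙ u ⊕ q ∙ v ⊕ r ∙ w

ev : ℝ → ℚ³ → ℝ
ev r ⟨ x , y , z ⟩ = fromℚ x + fromℚ y * r + fromℚ z * (r * r)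

ev-cong : ∀ r {u v} → u ≡ v → ev r u ≈ ev r v
ev-cong r refl = ≈-refl

ev-⊕ : ∀ r u v → ev r (u ⊕ v) ≈ ev r u + ev r v
ev-⊕ r ⟨ x , y , z ⟩ ⟨ x′ , y′ , z′ ⟩ = ≈-pointwise λ n → lemma (seq r n) x y z x′ y′ z′
  where
  lemma : ∀ r x y z x′ y′ z′ →
    x ℚ.+ x′ ℚ.+ (y ℚ.+ y′) ℚ.* r ℚ.+ (z ℚ.+ z′) ℚ.* (r ℚ.* r) ≡
    x ℚ.+ y ℚ.* r ℚ.+ z ℚ.* (r ℚ.* r) ℚ.+ (x′ ℚ.+ y′ ℚ.* r ℚ.+ z′ ℚ.* (r ℚ.* r))
  lemma = solve 7 (λ r x y z x′ y′ z′ →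
    x :+ x′ :+ (y :+ y′) :* r :+ (z :+ z′) :* (r :* r) :=
    x :+ y :* r :+ z :* (r :* r) :+ (x′ :+ y′ :* r :+ z′ :* (r :* r))) refl
    where open ℚ-Solver

ev-∙ : ∀ r s u → ev r (s ∙ u) ≈ fromℚ s * ev r u
ev-∙ r s ⟨ x , y , z ⟩ = ≈-pointwise λ n → lemma (seq r n) s x y z
  where
  lemma : ∀ r s x y z → s ℚ.* x ℚ.+ s ℚ.* y ℚ.* r ℚ.+ s ℚ.* z ℚ.* (r ℚ.* r) ≡
    s ℚ.* (x ℚ.+ y ℚ.* r ℚ.+ z ℚ.* (r ℚ.* r))
  lemma = solve 5 (λ r s x y z → s :* x :+ s :* y :* r :+ s :* z :* (r :* r) :=
    s :* (x :+ y :* r :+ z :* (r :* r))) refl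
    where open ℚ-Solver

ev-neg : ∀ r u → ev r (neg³ u) ≈ - ev r u
ev-neg r ⟨ x , y , z ⟩ = ≈-pointwise λ n → lemma (seq r n) x y z
  where
  lemma : ∀ r x y z → (ℚ.- x) ℚ.+ (ℚ.- y) ℚ.* r ℚ.+ (ℚ.- z) ℚ.* (r ℚ.* r) ≡
    ℚ.- (x ℚ.+ y ℚ.* r ℚ.+ z ℚ.* (r ℚ.* r))
  lemma = solve 4 (λ r x y z → (:- x) :+ (:- y) :* r :+ (:- z) :* (r :* r) :=
    :- (x :+ y :* r :+ z :* (r :* r))) refl
    where open ℚ-Solver

ev-const : ∀ r s → ev r ⟨ s , 0ℚ , 0ℚ ⟩ ≈ fromℚ s
ev-const r s = ≈-pointwise λ n → lemma (seq r n) s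
  where
  lemma : ∀ r s → s ℚ.+ 0ℚ ℚ.* r ℚ.+ 0ℚ ℚ.* (r ℚ.* r) ≡ s
  lemma = solve 2 (λ r s → s :+ con 0ℚ :* r :+ con 0ℚ :* (r :* r) := s) refl
    where open ℚ-Solver

ev-ρ : ∀ r → ev r ⟨ 0ℚ , 1ℚ , 0ℚ ⟩ ≈ r
ev-ρ r = ≈-pointwise λ n → lemma (seq r n)
  where
  lemma : ∀ r → 0ℚ ℚ.+ 1ℚ ℚ.* r ℚ.+ 0ℚ ℚ.* (r ℚ.* r) ≡ r
  lemma = solve 1 (λ r → con 0ℚ :+ con 1ℚ :* r :+ con 0ℚ :* (r :* r) := r) refl
    where open ℚ-Solver

ev-lincomb : ∀ r s u v w → ev r (lincomb s u v w) ≈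
  fromℚ (c₀ s) * ev r u + fromℚ (c₁ s) * ev r v + fromℚ (c₂ s) * ev r w
ev-lincomb r s u v w = begin
  ev r (c₀ s ∙ u ⊕ c₁ s ∙ v ⊕ c₂ s ∙ w)
    ≈⟨ ev-⊕ r _ _ ⟩
  ev r (c₀ s ∙ u ⊕ c₁ s ∙ v) + ev r (c₂ s ∙ w)
    ≈⟨ +-cong (ev-⊕ r _ _) (ev-∙ r (c₂ s) w) ⟩
  ev r (c₀ s ∙ u) + ev r (c₁ s ∙ v) + fromℚ (c₂ s) * ev r w
    ≈⟨ +-cong (+-cong (ev-∙ r (c₀ s) u) (ev-∙ r (c₁ s) v)) ≈-refl ⟩
  fromℚ (c₀ s) * ev r u + fromℚ (c₁ s) * ev r v + fromℚ (c₂ s) * ev r w ∎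
  where open ≈-Reasoning

module Cubic (a : ℤ) where

  α β : ℚ
  α = ι a
  β = α ℚ.+ ι (ℤ.+ 3)

  cubic : ℝ → ℝ
  cubic r = r * r * r + - (fromℚ α * (r * r)) + - (fromℚ β * r) + - 1ℝ

  Root : ℝ → Set
  Root r = cubic r ≈ 0ℝ

  simplestCubic-root : ∀ {r} → eval (simplestCubic a) r ≃ 0ℝ → Root r
  simplestCubic-root {r} p = ≈-trans {y = eval (simplestCubic a) r}
    (≈-pointwise λ n → trans (lemma α (ι (ℤ.+ 3)) (seq r n))
      (cong₂ (λ s t → ℚ.- 1ℚ ℚ.+ seq r n ℚ.* (s ℚ.+ seq r n ℚ.* (t ℚ.+ seq r n ℚ.* (1ℚ ℚ.+ seq r n ℚ.* 0ℚ))))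
        (sym (trans (ι-neg (a ℤ.+ ℤ.+ 3)) (cong ℚ.-_ (ι-+ a (ℤ.+ 3))))) (sym (ι-neg a)))) (wrap p)
    where
    lemma : ∀ a t r →
      r ℚ.* r ℚ.* r ℚ.+ ℚ.- (a ℚ.* (r ℚ.* r)) ℚ.+ ℚ.- ((a ℚ.+ t) ℚ.* r) ℚ.+ ℚ.- 1ℚ ≡
      ℚ.- 1ℚ ℚ.+ r ℚ.* (ℚ.- (a ℚ.+ t) ℚ.+ r ℚ.* (ℚ.- a ℚ.+ r ℚ.* (1ℚ ℚ.+ r ℚ.* 0ℚ)))
    lemma = solve 3 (λ a t r →
      r :* r :* r :+ :- (a :* (r :* r)) :+ :- ((a :+ t) :* r) :+ :- con 1ℚ :=
      :- con 1ℚ :+ r :* (:- (a :+ t) :+ r :* (:- a :+ r :* (con 1ℚ :+ r :* con 0ℚ)))) refl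
      where open ℚ-Solver

  -- Multiplication by ρ, reduced with ρ³ = αρ² + βρ + 1.
  shift : ℚ³ → ℚ³
  shift ⟨ x , y , z ⟩ = ⟨ z , x ℚ.+ β ℚ.* z , y ℚ.+ α ℚ.* z ⟩

  infixl 7 _⊗_
  _⊗_ : ℚ³ → ℚ³ → ℚ³
  u ⊗ v = lincomb u v (shift v) (shift (shift v))

  ev-shift : ∀ {r} → Root r → ∀ u → ev r (shift u) ≈ r * ev r u
  ev-shift {r} root ⟨ x , y , z ⟩ =
    ≈-sym (≈-mod (fromℚ z) root λ n → lemma α β (seq r n) x y z)
    where
    lemma : ∀ a b r x y z → r ℚ.* (x ℚ.+ y ℚ.* r ℚ.+ z ℚ.* (r ℚ.* r)) ≡
      z ℚ.+ (x ℚ.+ b ℚ.* z) ℚ.* r ℚ.+ (y ℚ.+ a ℚ.* z) ℚ.* (r ℚ.* r)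
      ℚ.+ z ℚ.* (r ℚ.* r ℚ.* r ℚ.+ ℚ.- (a ℚ.* (r ℚ.* r)) ℚ.+ ℚ.- (b ℚ.* r) ℚ.+ ℚ.- 1ℚ)
    lemma = solve 6 (λ a b r x y z → r :* (x :+ y :* r :+ z :* (r :* r)) :=
      z :+ (x :+ b :* z) :* r :+ (y :+ a :* z) :* (r :* r)
      :+ z :* (r :* r :* r :+ :- (a :* (r :* r)) :+ :- (b :* r) :+ :- con 1ℚ)) refl
      where open ℚ-Solver

  ev-⊗ : ∀ {r} → Root r → ∀ u v → ev r (u ⊗ v) ≈ ev r u * ev r v
  ev-⊗ {r} root u v = begin
    ev r (u ⊗ v)
      ≈⟨ ev-lincomb r u v (shift v) (shift (shift v)) ⟩
    fromℚ (c₀ u) * ev r v + fromℚ (c₁ u) * ev r (shift v) + fromℚ (c₂ u) * ev r (shift (shift v))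
      ≈⟨ +-cong (+-cong ≈-refl (*-cong ≈-refl (ev-shift root v)))
           (*-cong ≈-refl (≈-trans (ev-shift root (shift v)) (*-cong ≈-refl (ev-shift root v)))) ⟩
    fromℚ (c₀ u) * ev r v + fromℚ (c₁ u) * (r * ev r v) + fromℚ (c₂ u) * (r * (r * ev r v))
      ≈⟨ ≈-pointwise (λ n → lemma (seq r n) (c₀ u) (c₁ u) (c₂ u) (seq (ev r v) n)) ⟩
    ev r u * ev r v ∎
    where
    open ≈-Reasoning
    lemma : ∀ r x y z w → x ℚ.* w ℚ.+ y ℚ.* (r ℚ.* w) ℚ.+ z ℚ.* (r ℚ.* (r ℚ.* w)) ≡
      (x ℚ.+ y ℚ.* r ℚ.+ z ℚ.* (r ℚ.* r)) ℚ.* w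
    lemma = solve 5 (λ r x y z w → x :* w :+ y :* (r :* w) :+ z :* (r :* (r :* w)) :=
      (x :+ y :* r :+ z :* (r :* r)) :* w) refl
      where open ℚ-Solver

  -- The cofactors of the first column of the matrix with rows u, ρu, ρ²u; this is the norm times
  -- the inverse of u.
  adj : ℚ³ → ℚ³
  adj u = ⟨ c₁ p ℚ.* c₂ q ℚ.- c₁ q ℚ.* c₂ p , c₁ q ℚ.* c₂ u ℚ.- c₁ u ℚ.* c₂ q
          , c₁ u ℚ.* c₂ p ℚ.- c₁ p ℚ.* c₂ u ⟩
    where
    p q : ℚ³
    p = shift u
    q = shift p

  norm : ℚ³ → ℚ
  norm ⟨ x , y , z ⟩ = normForm ℚ.+-*-rawRing α β x y z

  -- The first coordinate is the expansion of the determinant along its first column, which is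
  -- literally `norm u`. The other two pair the cofactors with the wrong columns and vanish.
  adj-⊗ : ∀ u → adj u ⊗ u ≡ ⟨ norm u , 0ℚ , 0ℚ ⟩
  adj-⊗ u = ⟨⟩-cong refl (row₁ (c₁ u) (c₁ p) (c₁ q) (c₂ u) (c₂ p) (c₂ q))
                         (row₂ (c₁ u) (c₁ p) (c₁ q) (c₂ u) (c₂ p) (c₂ q))
    where
    p q : ℚ³
    p = shift u
    q = shift p
    open ℚ-Solver
    row₁ : ∀ u₁ p₁ q₁ u₂ p₂ q₂ → (p₁ ℚ.* q₂ ℚ.- q₁ ℚ.* p₂) ℚ.* u₁
      ℚ.+ (q₁ ℚ.* u₂ ℚ.- u₁ ℚ.* q₂) ℚ.* p₁ ℚ.+ (u₁ ℚ.* p₂ ℚ.- p₁ ℚ.* u₂) ℚ.* q₁ ≡ 0ℚ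
    row₁ = solve 6 (λ u₁ p₁ q₁ u₂ p₂ q₂ → (p₁ :* q₂ :- q₁ :* p₂) :* u₁
      :+ (q₁ :* u₂ :- u₁ :* q₂) :* p₁ :+ (u₁ :* p₂ :- p₁ :* u₂) :* q₁ := con 0ℚ) refl
    row₂ : ∀ u₁ p₁ q₁ u₂ p₂ q₂ → (p₁ ℚ.* q₂ ℚ.- q₁ ℚ.* p₂) ℚ.* u₂
      ℚ.+ (q₁ ℚ.* u₂ ℚ.- u₁ ℚ.* q₂) ℚ.* p₂ ℚ.+ (u₁ ℚ.* p₂ ℚ.- p₁ ℚ.* u₂) ℚ.* q₂ ≡ 0ℚ
    row₂ = solve 6 (λ u₁ p₁ q₁ u₂ p₂ q₂ → (p₁ :* q₂ :- q₁ :* p₂) :* u₂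
      :+ (q₁ :* u₂ :- u₁ :* q₂) :* p₂ :+ (u₁ :* p₂ :- p₁ :* u₂) :* q₂ := con 0ℚ) refl

  norm≡0 : ∀ u → norm u ≡ 0ℚ → u ≡ 0³
  norm≡0 ⟨ x , y , z ⟩ N≡0 =
    let x≡0 , y≡0 , z≡0 = normForm-ℚ-anisotropic a x y z N≡0 in ⟨⟩-cong x≡0 y≡0 z≡0

  -- Multiplication by `adj u` turns the vanishing of a real into that of the rational `norm u`, to
  -- which anisotropy applies. It works at every root, which later makes ρ ↦ r injective.
  ev-injective₀ : ∀ {r} → Root r → ∀ u → ev r u ≈ 0ℝ → u ≡ 0³
  ev-injective₀ {r} root u evu≈0 = norm≡0 u (fromℚ-injective (begin
    fromℚ (norm u)                 ≈⟨ ev-const r (norm u) ⟨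
    ev r ⟨ norm u , 0ℚ , 0ℚ ⟩      ≈⟨ ev-cong r (adj-⊗ u) ⟨
    ev r (adj u ⊗ u)               ≈⟨ ev-⊗ root (adj u) u ⟩
    ev r (adj u) * ev r u          ≈⟨ *-cong ≈-refl evu≈0 ⟩
    ev r (adj u) * 0ℝ              ≈⟨ ≈-pointwise (λ n → ℚ.*-zeroʳ (seq (ev r (adj u)) n)) ⟩
    0ℝ                             ∎))
    where open ≈-Reasoning

  ev-injective : ∀ {r} → Root r → ∀ u v → ev r u ≈ ev r v → u ≡ v
  ev-injective {r} root u v u≈v =
    ⟨⟩-cong (diff (cong c₀ u-v≡0)) (diff (cong c₁ u-v≡0)) (diff (cong c₂ u-v≡0))
    where
    open ≈-Reasoning
    u-v≡0 : u ⊕ neg³ v ≡ 0³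
    u-v≡0 = ev-injective₀ root (u ⊕ neg³ v) (begin
      ev r (u ⊕ neg³ v)        ≈⟨ ev-⊕ r u (neg³ v) ⟩
      ev r u + ev r (neg³ v)   ≈⟨ +-cong u≈v (ev-neg r v) ⟩
      ev r v + - ev r v        ≈⟨ ≈-pointwise (λ n → ℚ.+-inverseʳ (seq (ev r v) n)) ⟩
      0ℝ                       ∎)
    diff : ∀ {p q} → p ℚ.- q ≡ 0ℚ → p ≡ q
    diff {p} {q} p-q≡0 = trans (solve 2 (λ p q → p := (p :- q) :+ q) refl p q)
      (trans (cong (ℚ._+ q) p-q≡0) (ℚ.+-identityˡ q))
      where open ℚ-Solver

-- The trace of a linear map is independent of the basis

open RawMonoidDefs ℚ.+-0-rawMonoid using () renaming (sum to Σℚ) public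

comb : ∀ {n} → (Fin n → ℚ) → (Fin n → ℚ³) → ℚ³
comb {zero}  c E = 0³
comb {suc n} c E = c zero ∙ E zero ⊕ comb (c ∘ suc) (E ∘ suc)

Σℚ-cong : ∀ {n} {f g : Fin n → ℚ} → (∀ i → f i ≡ g i) → Σℚ f ≡ Σℚ g
Σℚ-cong {zero}  eq = refl
Σℚ-cong {suc n} eq = cong₂ ℚ._+_ (eq zero) (Σℚ-cong (eq ∘ suc))

comb-lincomb : ∀ {n} s (A B C : Fin n → ℚ) (E : Fin n → ℚ³) →
  comb (λ i → c₀ s ℚ.* A i ℚ.+ c₁ s ℚ.* B i ℚ.+ c₂ s ℚ.* C i) E ≡
  lincomb s (comb A E) (comb B E) (comb C E)
comb-lincomb {zero} s A B C E = ⟨⟩-cong lemma′ lemma′ lemma′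
  where
  lemma : ∀ p q r → 0ℚ ≡ p ℚ.* 0ℚ ℚ.+ q ℚ.* 0ℚ ℚ.+ r ℚ.* 0ℚ
  lemma = solve 3 (λ p q r → con 0ℚ := p :* con 0ℚ :+ q :* con 0ℚ :+ r :* con 0ℚ) refl
    where open ℚ-Solver
  lemma′ : 0ℚ ≡ c₀ s ℚ.* 0ℚ ℚ.+ c₁ s ℚ.* 0ℚ ℚ.+ c₂ s ℚ.* 0ℚ
  lemma′ = lemma (c₀ s) (c₁ s) (c₂ s)
comb-lincomb {suc n} s A B C E =
  trans (cong ((c₀ s ℚ.* A zero ℚ.+ c₁ s ℚ.* B zero ℚ.+ c₂ s ℚ.* C zero) ∙ E zero ⊕_)
      (comb-lincomb s (A ∘ suc) (B ∘ suc) (C ∘ suc) (E ∘ suc)))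
    (⟨⟩-cong (row c₀) (row c₁) (row c₂))
  where
  lemma : ∀ p q r x y z e X Y Z →
    (p ℚ.* x ℚ.+ q ℚ.* y ℚ.+ r ℚ.* z) ℚ.* e ℚ.+ (p ℚ.* X ℚ.+ q ℚ.* Y ℚ.+ r ℚ.* Z) ≡
    p ℚ.* (x ℚ.* e ℚ.+ X) ℚ.+ q ℚ.* (y ℚ.* e ℚ.+ Y) ℚ.+ r ℚ.* (z ℚ.* e ℚ.+ Z)
  lemma = solve 10 (λ p q r x y z e X Y Z →
    (p :* x :+ q :* y :+ r :* z) :* e :+ (p :* X :+ q :* Y :+ r :* Z) :=
    p :* (x :* e :+ X) :+ q :* (y :* e :+ Y) :+ r :* (z :* e :+ Z)) refl
    where open ℚ-Solver
  row : (π : ℚ³ → ℚ) → _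
  row π = lemma (c₀ s) (c₁ s) (c₂ s) (A zero) (B zero) (C zero) (π (E zero))
    (π (comb (A ∘ suc) (E ∘ suc))) (π (comb (B ∘ suc) (E ∘ suc))) (π (comb (C ∘ suc) (E ∘ suc)))

-- This is tr(PQ) = tr(QP) for the n × 3 matrix P with columns A, B, C and the 3 × n matrix Q with
-- columns F i. It compares a basis of any length n directly with 1, ρ, ρ².
Σℚ-pairing : ∀ {n} (A B C : Fin n → ℚ) (F : Fin n → ℚ³) →
  Σℚ (λ i → c₀ (F i) ℚ.* A i ℚ.+ c₁ (F i) ℚ.* B i ℚ.+ c₂ (F i) ℚ.* C i) ≡
  c₀ (comb A F) ℚ.+ c₁ (comb B F) ℚ.+ c₂ (comb C F)
Σℚ-pairing {zero}  A B C F = refl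
Σℚ-pairing {suc n} A B C F =
  trans (cong (c₀ (F zero) ℚ.* A zero ℚ.+ c₁ (F zero) ℚ.* B zero ℚ.+ c₂ (F zero) ℚ.* C zero ℚ.+_)
      (Σℚ-pairing (A ∘ suc) (B ∘ suc) (C ∘ suc) (F ∘ suc)))
    (lemma (c₀ (F zero)) (c₁ (F zero)) (c₂ (F zero)) (A zero) (B zero) (C zero)
      (c₀ (comb (A ∘ suc) (F ∘ suc))) (c₁ (comb (B ∘ suc) (F ∘ suc))) (c₂ (comb (C ∘ suc) (F ∘ suc))))
  where
  lemma : ∀ x y z a b c X Y Z →
    x ℚ.* a ℚ.+ y ℚ.* b ℚ.+ z ℚ.* c ℚ.+ (X ℚ.+ Y ℚ.+ Z) ≡
    a ℚ.* x ℚ.+ X ℚ.+ (b ℚ.* y ℚ.+ Y) ℚ.+ (c ℚ.* z ℚ.+ Z)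
  lemma = solve 9 (λ x y z a b c X Y Z →
    x :* a :+ y :* b :+ z :* c :+ (X :+ Y :+ Z) :=
    a :* x :+ X :+ (b :* y :+ Y) :+ (c :* z :+ Z)) refl
    where open ℚ-Solver

lincomb-linear : ∀ u s v v′ v″ w w′ w″ →
  lincomb u (s ∙ v ⊕ w) (s ∙ v′ ⊕ w′) (s ∙ v″ ⊕ w″) ≡ s ∙ lincomb u v v′ v″ ⊕ lincomb u w w′ w″
lincomb-linear ⟨ x , y , z ⟩ s v v′ v″ w w′ w″ = ⟨⟩-cong (row c₀) (row c₁) (row c₂)
  where
  lemma : ∀ x y z s a b c A B C →
    x ℚ.* (s ℚ.* a ℚ.+ A) ℚ.+ y ℚ.* (s ℚ.* b ℚ.+ B) ℚ.+ z ℚ.* (s ℚ.* c ℚ.+ C) ≡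
    s ℚ.* (x ℚ.* a ℚ.+ y ℚ.* b ℚ.+ z ℚ.* c) ℚ.+ (x ℚ.* A ℚ.+ y ℚ.* B ℚ.+ z ℚ.* C)
  lemma = solve 10 (λ x y z s a b c A B C →
    x :* (s :* a :+ A) :+ y :* (s :* b :+ B) :+ z :* (s :* c :+ C) :=
    s :* (x :* a :+ y :* b :+ z :* c) :+ (x :* A :+ y :* B :+ z :* C)) refl
    where open ℚ-Solver
  row : (π : ℚ³ → ℚ) → _
  row π = lemma x y z s (π v) (π v′) (π v″) (π w) (π w′) (π w″)

lincomb-∙ : ∀ s u v v′ v″ → lincomb (s ∙ u) v v′ v″ ≡ s ∙ lincomb u v v′ v″
lincomb-∙ s ⟨ x , y , z ⟩ v v′ v″ = ⟨⟩-cong (row c₀) (row c₁) (row c₂)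
  where
  lemma : ∀ s x y z a b c → s ℚ.* x ℚ.* a ℚ.+ s ℚ.* y ℚ.* b ℚ.+ s ℚ.* z ℚ.* c ≡
    s ℚ.* (x ℚ.* a ℚ.+ y ℚ.* b ℚ.+ z ℚ.* c)
  lemma = solve 7 (λ s x y z a b c → s :* x :* a :+ s :* y :* b :+ s :* z :* c :=
    s :* (x :* a :+ y :* b :+ z :* c)) refl
    where open ℚ-Solver
  row : (π : ℚ³ → ℚ) → _
  row π = lemma s x y z (π v) (π v′) (π v″)

e₁ e₂ : ℚ³
e₁ = ⟨ 0ℚ , 1ℚ , 0ℚ ⟩
e₂ = ⟨ 0ℚ , 0ℚ , 1ℚ ⟩

lincomb-basis : ∀ u → lincomb u 1³ e₁ e₂ ≡ u
lincomb-basis ⟨ x , y , z ⟩ = ⟨⟩-cong (l₀ x y z) (l₁ x y z) (l₂ x y z)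
  where
  open ℚ-Solver
  l₀ : ∀ x y z → x ℚ.* 1ℚ ℚ.+ y ℚ.* 0ℚ ℚ.+ z ℚ.* 0ℚ ≡ x
  l₀ = solve 3 (λ x y z → x :* con 1ℚ :+ y :* con 0ℚ :+ z :* con 0ℚ := x) refl
  l₁ : ∀ x y z → x ℚ.* 0ℚ ℚ.+ y ℚ.* 1ℚ ℚ.+ z ℚ.* 0ℚ ≡ y
  l₁ = solve 3 (λ x y z → x :* con 0ℚ :+ y :* con 1ℚ :+ z :* con 0ℚ := y) refl
  l₂ : ∀ x y z → x ℚ.* 0ℚ ℚ.+ y ℚ.* 0ℚ ℚ.+ z ℚ.* 1ℚ ≡ z
  l₂ = solve 3 (λ x y z → x :* con 0ℚ :+ y :* con 0ℚ :+ z :* con 1ℚ := z) refl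

comb-injective : ∀ {n} (E : Fin n → ℚ³) → (∀ c → comb c E ≡ 0³ → ∀ i → c i ≡ 0ℚ) →
  ∀ A B → comb A E ≡ comb B E → ∀ i → A i ≡ B i
comb-injective E independent A B eq i = conclude (A i) (B i)
  (independent _ (trans (comb-lincomb s A B B E)
    (trans (cong (λ X → lincomb s X (comb B E) (comb B E)) eq) (⟨⟩-cong (row c₀) (row c₁) (row c₂)))) i)
  where
  s : ℚ³
  -- These coefficients make `comb-lincomb` serve for the difference A - B; the third family is a
  -- dummy with weight 0.
  s = ⟨ 1ℚ , ℚ.- 1ℚ , 0ℚ ⟩
  lemma : ∀ x → 1ℚ ℚ.* x ℚ.+ ℚ.- 1ℚ ℚ.* x ℚ.+ 0ℚ ℚ.* x ≡ 0ℚ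
  lemma = solve 1 (λ x → con 1ℚ :* x :+ :- con 1ℚ :* x :+ con 0ℚ :* x := con 0ℚ) refl
    where open ℚ-Solver
  row : (π : ℚ³ → ℚ) → _
  row π = lemma (π (comb B E))
  expand : ∀ x y → x ≡ (1ℚ ℚ.* x ℚ.+ ℚ.- 1ℚ ℚ.* y ℚ.+ 0ℚ ℚ.* y) ℚ.+ y
  expand = solve 2 (λ x y → x := (con 1ℚ :* x :+ :- con 1ℚ :* y :+ con 0ℚ :* y) :+ y) refl
    where open ℚ-Solver
  conclude : ∀ x y → 1ℚ ℚ.* x ℚ.+ ℚ.- 1ℚ ℚ.* y ℚ.+ 0ℚ ℚ.* y ≡ 0ℚ → x ≡ y
  conclude x y p = trans (expand x y) (trans (cong (ℚ._+ y) p) (ℚ.+-identityˡ y))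

module Trace (a : ℤ) where
  open Cubic a

  shift-linear : ∀ s v w → shift (s ∙ v ⊕ w) ≡ s ∙ shift v ⊕ shift w
  shift-linear s ⟨ x , y , z ⟩ ⟨ x′ , y′ , z′ ⟩ =
    ⟨⟩-cong refl (lemma β s x z x′ z′) (lemma α s y z y′ z′)
    where
    lemma : ∀ b s x z x′ z′ → s ℚ.* x ℚ.+ x′ ℚ.+ b ℚ.* (s ℚ.* z ℚ.+ z′) ≡
      s ℚ.* (x ℚ.+ b ℚ.* z) ℚ.+ (x′ ℚ.+ b ℚ.* z′)
    lemma = solve 6 (λ b s x z x′ z′ → s :* x :+ x′ :+ b :* (s :* z :+ z′) :=
      s :* (x :+ b :* z) :+ (x′ :+ b :* z′)) refl
      where open ℚ-Solver

  ⊗-linear : ∀ u s v w → u ⊗ (s ∙ v ⊕ w) ≡ s ∙ (u ⊗ v) ⊕ u ⊗ w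
  ⊗-linear u s v w = trans
    (cong₂ (lincomb u (s ∙ v ⊕ w)) (shift-linear s v w)
      (trans (cong shift (shift-linear s v w)) (shift-linear s (shift v) (shift w))))
    (lincomb-linear u s v (shift v) (shift (shift v)) w (shift w) (shift (shift w)))

  ∙-⊗ : ∀ s u v → (s ∙ u) ⊗ v ≡ s ∙ (u ⊗ v)
  ∙-⊗ s u v = lincomb-∙ s u v (shift v) (shift (shift v))

  ⊗-zeroʳ : ∀ u → u ⊗ 0³ ≡ 0³
  ⊗-zeroʳ ⟨ x , y , z ⟩ = trans
    (cong₂ (lincomb ⟨ x , y , z ⟩ 0³) shift0 (trans (cong shift shift0) shift0))
    (⟨⟩-cong (zeros x y z) (zeros x y z) (zeros x y z))
    where
    open ℚ-Solver
    zero+*0 : ∀ b → 0ℚ ℚ.+ b ℚ.* 0ℚ ≡ 0ℚ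
    zero+*0 = solve 1 (λ b → con 0ℚ :+ b :* con 0ℚ := con 0ℚ) refl
    shift0 : shift 0³ ≡ 0³
    shift0 = ⟨⟩-cong refl (zero+*0 β) (zero+*0 α)
    zeros : ∀ x y z → x ℚ.* 0ℚ ℚ.+ y ℚ.* 0ℚ ℚ.+ z ℚ.* 0ℚ ≡ 0ℚ
    zeros = solve 3 (λ x y z → x :* con 0ℚ :+ y :* con 0ℚ :+ z :* con 0ℚ := con 0ℚ) refl

  comb-⊗ : ∀ {n} u c (E : Fin n → ℚ³) → comb c (λ i → u ⊗ E i) ≡ u ⊗ comb c E
  comb-⊗ {zero}  u c E = sym (⊗-zeroʳ u)
  comb-⊗ {suc n} u c E = trans
    (cong (c zero ∙ (u ⊗ E zero) ⊕_) (comb-⊗ u (c ∘ suc) (E ∘ suc)))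
    (sym (⊗-linear u (c zero) (E zero) (comb (c ∘ suc) (E ∘ suc))))

  -- The coefficients 3, α and α² + 2β are the power sums of exponents 0, 1, 2 of the three roots,
  -- by Newton's identities.
  tr : ℚ³ → ℚ
  tr ⟨ x , y , z ⟩ = ι (ℤ.+ 3) ℚ.* x ℚ.+ α ℚ.* y ℚ.+ (α ℚ.* α ℚ.+ (β ℚ.+ β)) ℚ.* z

  diagonal : ∀ u → c₀ (u ⊗ 1³) ℚ.+ c₁ (u ⊗ e₁) ℚ.+ c₂ (u ⊗ e₂) ≡ tr u
  diagonal ⟨ x , y , z ⟩ = lemma α β x y z
    where
    lemma : ∀ a b x y z →
      x ℚ.* 1ℚ ℚ.+ y ℚ.* 0ℚ ℚ.+ z ℚ.* (0ℚ ℚ.+ a ℚ.* 0ℚ)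
      ℚ.+ (x ℚ.* 1ℚ ℚ.+ y ℚ.* (0ℚ ℚ.+ b ℚ.* 0ℚ) ℚ.+ z ℚ.* (0ℚ ℚ.+ b ℚ.* (1ℚ ℚ.+ a ℚ.* 0ℚ)))
      ℚ.+ (x ℚ.* 1ℚ ℚ.+ y ℚ.* (0ℚ ℚ.+ a ℚ.* 1ℚ) ℚ.+ z ℚ.* (0ℚ ℚ.+ b ℚ.* 1ℚ ℚ.+ a ℚ.* (0ℚ ℚ.+ a ℚ.* 1ℚ)))
      ≡ ι (ℤ.+ 3) ℚ.* x ℚ.+ a ℚ.* y ℚ.+ (a ℚ.* a ℚ.+ (b ℚ.+ b)) ℚ.* z
    lemma = solve 5 (λ a b x y z →
      x :* con 1ℚ :+ y :* con 0ℚ :+ z :* (con 0ℚ :+ a :* con 0ℚ)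
      :+ (x :* con 1ℚ :+ y :* (con 0ℚ :+ b :* con 0ℚ) :+ z :* (con 0ℚ :+ b :* (con 1ℚ :+ a :* con 0ℚ)))
      :+ (x :* con 1ℚ :+ y :* (con 0ℚ :+ a :* con 1ℚ) :+ z :* (con 0ℚ :+ b :* con 1ℚ :+ a :* (con 0ℚ :+ a :* con 1ℚ)))
      := con (ι (ℤ.+ 3)) :* x :+ a :* y :+ (a :* a :+ (b :+ b)) :* z) refl
      where open ℚ-Solver

  -- If v = Σ ψ(v)ᵢ Eᵢ then Mᵢⱼ = ψ(u Eⱼ)ᵢ, and Σ ψ(u Eᵢ)ᵢ is the trace of
  -- multiplication by u in the basis 1, ρ, ρ².
  trace-invariant : ∀ {n} (E : Fin n → ℚ³) (M : Fin n → Fin n → ℚ) u →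
    (∀ v → ∃[ c ] comb c E ≡ v) → (∀ c → comb c E ≡ 0³ → ∀ i → c i ≡ 0ℚ) →
    (∀ j → u ⊗ E j ≡ comb (λ i → M i j) E) → Σℚ (λ i → M i i) ≡ tr u
  trace-invariant {n} E M u spanning independent matrix =
    let A , A≡ = spanning 1³
        B , B≡ = spanning e₁
        C , C≡ = spanning e₂
        ψ : ℚ³ → Fin n → ℚ
        ψ v i = c₀ v ℚ.* A i ℚ.+ c₁ v ℚ.* B i ℚ.+ c₂ v ℚ.* C i
        comb-ψ : ∀ v → comb (ψ v) E ≡ v
        comb-ψ v = trans (comb-lincomb v A B C E)
          (trans (cong₂ (λ f X → f X) (cong₂ (lincomb v) A≡ B≡) C≡) (lincomb-basis v))
        entry : ∀ i j → M i j ≡ ψ (u ⊗ E j) i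
        entry i j = comb-injective E independent (λ i → M i j) (ψ (u ⊗ E j))
          (trans (sym (matrix j)) (sym (comb-ψ (u ⊗ E j)))) i
        column : ∀ X {v} → comb X E ≡ v → comb X (λ i → u ⊗ E i) ≡ u ⊗ v
        column X eq = trans (comb-⊗ u X E) (cong (u ⊗_) eq)
    in begin
      Σℚ (λ i → M i i)
        ≡⟨ Σℚ-cong (λ i → entry i i) ⟩
      Σℚ (λ i → ψ (u ⊗ E i) i)
        ≡⟨ Σℚ-pairing A B C (λ i → u ⊗ E i) ⟩
      c₀ (comb A (λ i → u ⊗ E i)) ℚ.+ c₁ (comb B (λ i → u ⊗ E i)) ℚ.+ c₂ (comb C (λ i → u ⊗ E i))
        ≡⟨ cong₂ ℚ._+_ (cong₂ ℚ._+_ (cong c₀ (column A A≡)) (cong c₁ (column B B≡))) (cong c₂ (column C C≡)) ⟩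
      c₀ (u ⊗ 1³) ℚ.+ c₁ (u ⊗ e₁) ℚ.+ c₂ (u ⊗ e₂)
        ≡⟨ diagonal u ⟩
      tr u ∎
    where open ≡-Reasoning

-- Coordinates, real embeddings and traces in ℚ(ρ)

*-congʳ-1 : ∀ {x y z} → x * y ≈ 1ℝ → z * x ≈ 1ℝ → y ≈ z
*-congʳ-1 {x} {y} {z} xy≈1 zx≈1 = begin
  y            ≈⟨ ≈-pointwise (λ n → ℚ.*-identityˡ (seq y n)) ⟨
  1ℝ * y       ≈⟨ *-cong zx≈1 ≈-refl ⟨
  z * x * y    ≈⟨ ≈-pointwise (λ n → ℚ.*-assoc (seq z n) (seq x n) (seq y n)) ⟩
  z * (x * y)  ≈⟨ *-cong ≈-refl xy≈1 ⟩
  z * 1ℝ       ≈⟨ ≈-pointwise (λ n → ℚ.*-identityʳ (seq z n)) ⟩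
  z            ∎
  where open ≈-Reasoning

component : ℚ³ → Fin 3 → ℚ
component u zero             = c₀ u
component u (suc zero)       = c₁ u
component u (suc (suc zero)) = c₂ u

basis³ : Fin 3 → ℚ³
basis³ zero             = 1³
basis³ (suc zero)       = e₁
basis³ (suc (suc zero)) = e₂

comb-basis³ : ∀ c → comb c basis³ ≡ ⟨ c zero , c (suc zero) , c (suc (suc zero)) ⟩
comb-basis³ c = ⟨⟩-cong (l₀ p q r) (l₁ p q r) (l₂ p q r)
  where
  p q r : ℚ
  p = c zero
  q = c (suc zero)
  r = c (suc (suc zero))
  open ℚ-Solver
  l₀ : ∀ x y z → x ℚ.* 1ℚ ℚ.+ (y ℚ.* 0ℚ ℚ.+ (z ℚ.* 0ℚ ℚ.+ 0ℚ)) ≡ x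
  l₀ = solve 3 (λ x y z → x :* con 1ℚ :+ (y :* con 0ℚ :+ (z :* con 0ℚ :+ con 0ℚ)) := x) refl
  l₁ : ∀ x y z → x ℚ.* 0ℚ ℚ.+ (y ℚ.* 1ℚ ℚ.+ (z ℚ.* 0ℚ ℚ.+ 0ℚ)) ≡ y
  l₁ = solve 3 (λ x y z → x :* con 0ℚ :+ (y :* con 1ℚ :+ (z :* con 0ℚ :+ con 0ℚ)) := y) refl
  l₂ : ∀ x y z → x ℚ.* 0ℚ ℚ.+ (y ℚ.* 0ℚ ℚ.+ (z ℚ.* 1ℚ ℚ.+ 0ℚ)) ≡ z
  l₂ = solve 3 (λ x y z → x :* con 0ℚ :+ (y :* con 0ℚ :+ (z :* con 1ℚ :+ con 0ℚ)) := z) refl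

comb-component : ∀ u → comb (component u) basis³ ≡ u
comb-component u = comb-basis³ (component u)

module Field (a : ℤ) (ρ : ℝ) (ρ-root : Cubic.Root a ρ) where
  open NumberField ρ
  open Cubic a
  open Trace a

  ev-∈ : ∀ u → ev ρ u ∈ℚ⟨ ρ ⟩
  ev-∈ ⟨ x , y , z ⟩ = add (add (rat x) (mul (rat y) gen)) (mul (rat z) (mul gen gen))

  evᴷ : ℚ³ → K
  evᴷ u = ev ρ u by ev-∈ u

  ⊗-inverse : ∀ u → norm u ≢ 0ℚ → ∃[ w ] w ⊗ u ≡ 1³
  ⊗-inverse u N≢0 = d ∙ adj u , trans (∙-⊗ d (adj u) u)
    (trans (cong (d ∙_) (adj-⊗ u))
      (⟨⟩-cong (ℚ.*-inverseˡ (norm u) {{nz}}) (ℚ.*-zeroʳ d) (ℚ.*-zeroʳ d)))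
    where
    nz : ℚ.NonZero (norm u)
    nz = ℚ.≢-nonZero N≢0
    d : ℚ
    d = ℚ.1/_ (norm u) {{nz}}

  ev-inverse : ∀ {r} → Root r → ∀ {u w} → w ⊗ u ≡ 1³ → ev r w * ev r u ≈ 1ℝ
  ev-inverse {r} root {u} {w} wu≡1 =
    ≈-trans (≈-sym (ev-⊗ root w u)) (≈-trans (ev-cong r wu≡1) (ev-const r 1ℚ))

  coordinates : ∀ {x} → x ∈ℚ⟨ ρ ⟩ → ∃[ u ] x ≈ ev ρ u
  coordinates gen = e₁ , ≈-sym (ev-ρ ρ)
  coordinates (rat q) = ⟨ q , 0ℚ , 0ℚ ⟩ , ≈-sym (ev-const ρ q)
  coordinates (add p q) =
    let u , x≈ = coordinates p ; v , y≈ = coordinates q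
    in u ⊕ v , ≈-trans (+-cong x≈ y≈) (≈-sym (ev-⊕ ρ u v))
  coordinates (mul p q) =
    let u , x≈ = coordinates p ; v , y≈ = coordinates q
    in u ⊗ v , ≈-trans (*-cong x≈ y≈) (≈-sym (ev-⊗ ρ-root u v))
  coordinates (neg p) =
    let u , x≈ = coordinates p in neg³ u , ≈-trans (-‿cong x≈) (≈-sym (ev-neg ρ u))
  coordinates (resp x≃y p) =
    let u , x≈ = coordinates p in u , ≈-trans (≈-sym (wrap x≃y)) x≈
  -- Whether x vanishes is decided through its rational norm: norm zero would give 0 · y = 1, and
  -- otherwise the inverse computed in coordinates agrees with y.
  coordinates (inv {x = x} {y} p xy≃1) =
    let u , x≈ = coordinates p in invert u x≈ (norm u ℚ.≟ 0ℚ)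
    where
    open ≈-Reasoning
    invert : ∀ u → x ≈ ev ρ u → Dec (norm u ≡ 0ℚ) → ∃[ w ] y ≈ ev ρ w
    invert u x≈ (yes N≡0) = contradiction (fromℚ-injective (begin
      0ℝ          ≈⟨ ≈-pointwise (λ n → ℚ.*-zeroˡ (seq y n)) ⟨
      0ℝ * y      ≈⟨ *-cong (≈-trans x≈ (≈-trans (ev-cong ρ (norm≡0 u N≡0)) (ev-const ρ 0ℚ))) ≈-refl ⟨
      x * y       ≈⟨ wrap xy≃1 ⟩
      1ℝ          ∎)) λ ()
    invert u x≈ (no N≢0) =
      let w , wu≡1 = ⊗-inverse u N≢0
      in w , *-congʳ-1 {x} (wrap xy≃1) (≈-trans (*-cong ≈-refl x≈) (ev-inverse ρ-root {u} {w} wu≡1))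

  coord : K → ℚ³
  coord x = proj₁ (coordinates (member x))

  value≈ : ∀ x → value x ≈ ev ρ (coord x)
  value≈ x = proj₂ (coordinates (member x))

  -- Coordinates are read off the derivation of membership, so equal reals could a priori receive
  -- different ones; injectivity of `ev` at ρ rules this out.
  coord-unique : ∀ x {u} → value x ≈ ev ρ u → coord x ≡ u
  coord-unique x {u} eq = ev-injective ρ-root (coord x) u (≈-trans (≈-sym (value≈ x)) eq)

  coord-cong : ∀ {x y} → x ≈ᴷ y → coord x ≡ coord y
  coord-cong {x} {y} x≃y = coord-unique x (≈-trans (wrap x≃y) (value≈ y))

  coord-+ : ∀ x y → coord (x +ᴷ y) ≡ coord x ⊕ coord y
  coord-+ x y = coord-unique (x +ᴷ y)
    (≈-trans (+-cong (value≈ x) (value≈ y)) (≈-sym (ev-⊕ ρ (coord x) (coord y))))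

  coord-* : ∀ x y → coord (x *ᴷ y) ≡ coord x ⊗ coord y
  coord-* x y = coord-unique (x *ᴷ y)
    (≈-trans (*-cong (value≈ x) (value≈ y)) (≈-sym (ev-⊗ ρ-root (coord x) (coord y))))

  coord-neg : ∀ x → coord (-ᴷ x) ≡ neg³ (coord x)
  coord-neg x = coord-unique (-ᴷ x)
    (≈-trans (-‿cong (value≈ x)) (≈-sym (ev-neg ρ (coord x))))

  embedding : ℝ → K → ℝ
  embedding r x = ev r (coord x)

  embedding-isRealEmbedding : ∀ {r} → Root r → IsRealEmbedding (embedding r)
  embedding-isRealEmbedding {r} root = record
    { isRingHomomorphism = record
      { isSemiringHomomorphism = record
        { isNearSemiringHomomorphism = record
          { +-isMonoidHomomorphism = record
            { isMagmaHomomorphism = record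
              { isRelHomomorphism = record
                { cong = λ {x} {y} x≃y → unwrap (ev-cong r (coord-cong {x} {y} x≃y)) }
              ; homo = λ x y → unwrap (≈-trans (ev-cong r (coord-+ x y)) (ev-⊕ r (coord x) (coord y))) }
            ; ε-homo = unwrap (const-homo 0ℚ) }
          ; *-homo = λ x y → unwrap (≈-trans (ev-cong r (coord-* x y)) (ev-⊗ root (coord x) (coord y))) }
        ; 1#-homo = unwrap (const-homo 1ℚ) }
      ; -‿homo = λ x → unwrap (≈-trans (ev-cong r (coord-neg x)) (ev-neg r (coord x))) }
    ; injective = λ {x} {y} eq → unwrap (≈-trans (value≈ x)
        (≈-trans (ev-cong ρ (ev-injective root (coord x) (coord y) (wrap eq))) (≈-sym (value≈ y)))) }
    where
    const-homo : ∀ q → embedding r (fromℚ q by rat q) ≈ fromℚ q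
    const-homo q = ≈-trans (ev-cong r (coord-unique (fromℚ q by rat q) (≈-sym (ev-const ρ q)))) (ev-const r q)

  combination-comb : ∀ {n} (e : Fin n → K) (E : Fin n → ℚ³) → (∀ i → value (e i) ≈ ev ρ (E i)) →
    ∀ c → combination c e ≈ ev ρ (comb c E)
  combination-comb {zero}  e E e≈ c = ≈-sym (ev-const ρ 0ℚ)
  combination-comb {suc n} e E e≈ c = ≈-trans
    (+-cong (≈-trans (*-cong ≈-refl (e≈ zero)) (≈-sym (ev-∙ ρ (c zero) (E zero))))
            (combination-comb (e ∘ suc) (E ∘ suc) (e≈ ∘ suc) (c ∘ suc)))
    (≈-sym (ev-⊕ ρ (c zero ∙ E zero) (comb (c ∘ suc) (E ∘ suc))))

  hasTrace⇒tr : ∀ X {t u} → value X ≈ ev ρ u → HasTrace X t → t ≡ tr u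
  hasTrace⇒tr X {t} {u} X≈ (n , e , isBasis , M , matrix , t≡) =
    trans t≡ (trace-invariant E M u spanning³ independent³ matrix³)
    where
    open IsBasis isBasis
    E : Fin n → ℚ³
    E i = coord (e i)
    combE : ∀ c → combination c e ≈ ev ρ (comb c E)
    combE = combination-comb e E (λ i → value≈ (e i))
    spanning³ : ∀ v → ∃[ c ] comb c E ≡ v
    spanning³ v = let c , v≃ = spanning (evᴷ v) in
      c , ev-injective ρ-root (comb c E) v (≈-sym (≈-trans (wrap v≃) (combE c)))
    independent³ : ∀ c → comb c E ≡ 0³ → ∀ i → c i ≡ 0ℚ
    independent³ c eq = independent c
      (unwrap (≈-trans (combE c) (≈-trans (ev-cong ρ eq) (ev-const ρ 0ℚ))))
    matrix³ : ∀ j → u ⊗ E j ≡ comb (λ i → M i j) E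
    matrix³ j = ev-injective ρ-root (u ⊗ E j) _
      (≈-trans (ev-⊗ ρ-root u (E j)) (≈-trans (*-cong (≈-sym X≈) (≈-sym (value≈ (e j))))
        (≈-trans (wrap (matrix j)) (combE (λ i → M i j)))))

  tr⇒hasTrace : ∀ X {u} → value X ≈ ev ρ u → HasTrace X (tr u)
  tr⇒hasTrace X {u} X≈ = 3 , basis , isBasis , M , matrix , trace≡
    where
    basis : Fin 3 → K
    basis i = evᴷ (basis³ i)
    M : Fin 3 → Fin 3 → ℚ
    M i j = component (u ⊗ basis³ j) i
    comb-ev : ∀ c → combination c basis ≈ ev ρ (comb c basis³)
    comb-ev = combination-comb basis basis³ (λ _ → ≈-refl)
    combine : ∀ v → ev ρ v ≈ combination (component v) basis
    combine v = ≈-sym (≈-trans (comb-ev (component v)) (ev-cong ρ (comb-component v)))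
    isBasis : IsBasis basis
    isBasis = record
      { spanning = λ x → component (coord x) , unwrap (≈-trans (value≈ x) (combine (coord x)))
      ; independent = λ c eq → zeros c (trans (sym (comb-basis³ c))
          (ev-injective₀ ρ-root (comb c basis³) (≈-trans (≈-sym (comb-ev c)) (wrap eq)))) }
      where
      zeros : ∀ c → ⟨ c zero , c (suc zero) , c (suc (suc zero)) ⟩ ≡ 0³ → ∀ i → c i ≡ 0ℚ
      zeros c eq zero             = cong c₀ eq
      zeros c eq (suc zero)       = cong c₁ eq
      zeros c eq (suc (suc zero)) = cong c₂ eq
    matrix : ∀ j → value (X *ᴷ basis j) ≃ combination (λ i → M i j) basis
    matrix j = unwrap (≈-trans (*-cong X≈ ≈-refl)
      (≈-trans (≈-sym (ev-⊗ ρ-root u (basis³ j))) (combine (u ⊗ basis³ j))))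
    trace≡ : tr u ≡ Σℚ (λ i → M i i)
    trace≡ = trans (sym (diagonal u)) (lemma (c₀ (u ⊗ 1³)) (c₁ (u ⊗ e₁)) (c₂ (u ⊗ e₂)))
      where
      lemma : ∀ x y z → x ℚ.+ y ℚ.+ z ≡ x ℚ.+ (y ℚ.+ (z ℚ.+ 0ℚ))
      lemma = solve 3 (λ x y z → x :+ y :+ z := x :+ (y :+ (z :+ con 0ℚ))) refl
        where open ℚ-Solver

-- Conjugates and total positivity

-- Here x = x² · y, and the square of the invertible x is positive.
pos-cofactor : ∀ x y → x * y ≈ 1ℝ → 0ℝ < y → 0ℝ < x
pos-cofactor x y xy≈1 0<y = pos-resp-≈ {x * x * y} {x}
  (begin
    x * x * y    ≈⟨ ≈-pointwise (λ n → ℚ.*-assoc (seq x n) (seq x n) (seq y n)) ⟩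
    x * (x * y)  ≈⟨ *-cong ≈-refl xy≈1 ⟩
    x * 1ℝ       ≈⟨ ≈-pointwise (λ n → ℚ.*-identityʳ (seq x n)) ⟩
    x            ∎)
  (pos-* {x * x} {y} (unit-square-pos {x} {y} xy≈1) 0<y)
  where open ≈-Reasoning

2ℚ 3ℚ : ℚ
2ℚ = ι (ℤ.+ 2)
3ℚ = ι (ℤ.+ 3)

ω³ 1+ρ : ℚ³
ω³ = ⟨ 1ℚ , 1ℚ , 1ℚ ⟩
1+ρ = ⟨ 1ℚ , 1ℚ , 0ℚ ⟩

φ : ℚ³ → ℚ
φ ⟨ x , y , z ⟩ = 2ℚ ℚ.* x ℚ.- y ℚ.+ z

module Positivity (a : ℤ) where
  open Cubic a
  open Trace a

  conj₁ conj₂ : ℚ³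
  conj₁ = ⟨ α ℚ.+ 2ℚ , α , ℚ.- 1ℚ ⟩
  conj₂ = ⟨ ℚ.- 2ℚ , ℚ.- (α ℚ.+ 1ℚ) , 1ℚ ⟩

  -- The quotients are f(ρ′)/f(ρ) and f(ρ″)/f(ρ) for the cubic f.
  conj₁-root : ∀ {ρ} → Root ρ → Root (ev ρ conj₁)
  conj₁-root {ρ} root = ≈-mod
    (fromℚ (ℚ.- (1ℚ ℚ.+ 3ℚ ℚ.* α ℚ.+ α ℚ.* α)) + fromℚ (3ℚ ℚ.+ α ℚ.- α ℚ.* α) * ρ
      + fromℚ (2ℚ ℚ.* α) * (ρ * ρ) + - (ρ * ρ * ρ)) root λ n → lemma α (seq ρ n)
    where
    lemma : ∀ a r → let s = a ℚ.+ 2ℚ ℚ.+ a ℚ.* r ℚ.+ ℚ.- 1ℚ ℚ.* (r ℚ.* r) in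
      s ℚ.* s ℚ.* s ℚ.+ ℚ.- (a ℚ.* (s ℚ.* s)) ℚ.+ ℚ.- ((a ℚ.+ 3ℚ) ℚ.* s) ℚ.+ ℚ.- 1ℚ ≡
      0ℚ ℚ.+ (ℚ.- (1ℚ ℚ.+ 3ℚ ℚ.* a ℚ.+ a ℚ.* a) ℚ.+ (3ℚ ℚ.+ a ℚ.- a ℚ.* a) ℚ.* r
        ℚ.+ 2ℚ ℚ.* a ℚ.* (r ℚ.* r) ℚ.+ ℚ.- (r ℚ.* r ℚ.* r)) ℚ.*
        (r ℚ.* r ℚ.* r ℚ.+ ℚ.- (a ℚ.* (r ℚ.* r)) ℚ.+ ℚ.- ((a ℚ.+ 3ℚ) ℚ.* r) ℚ.+ ℚ.- 1ℚ)
    lemma = solve 2 (λ a r → let s = a :+ con 2ℚ :+ a :* r :+ :- con 1ℚ :* (r :* r) in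
      s :* s :* s :+ :- (a :* (s :* s)) :+ :- ((a :+ con 3ℚ) :* s) :+ :- con 1ℚ :=
      con 0ℚ :+ (:- (con 1ℚ :+ con 3ℚ :* a :+ a :* a) :+ (con 3ℚ :+ a :- a :* a) :* r
        :+ con 2ℚ :* a :* (r :* r) :+ :- (r :* r :* r)) :*
        (r :* r :* r :+ :- (a :* (r :* r)) :+ :- ((a :+ con 3ℚ) :* r) :+ :- con 1ℚ)) refl
      where open ℚ-Solver

  conj₂-root : ∀ {ρ} → Root ρ → Root (ev ρ conj₂)
  conj₂-root {ρ} root = ≈-mod
    (fromℚ (3ℚ ℚ.+ 2ℚ ℚ.* α) + fromℚ (3ℚ ℚ.* α ℚ.+ α ℚ.* α) * ρ
      + fromℚ (ℚ.- (3ℚ ℚ.+ 2ℚ ℚ.* α)) * (ρ * ρ) + ρ * ρ * ρ) root λ n → lemma α (seq ρ n)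
    where
    lemma : ∀ a r → let s = ℚ.- 2ℚ ℚ.+ ℚ.- (a ℚ.+ 1ℚ) ℚ.* r ℚ.+ 1ℚ ℚ.* (r ℚ.* r) in
      s ℚ.* s ℚ.* s ℚ.+ ℚ.- (a ℚ.* (s ℚ.* s)) ℚ.+ ℚ.- ((a ℚ.+ 3ℚ) ℚ.* s) ℚ.+ ℚ.- 1ℚ ≡
      0ℚ ℚ.+ (3ℚ ℚ.+ 2ℚ ℚ.* a ℚ.+ (3ℚ ℚ.* a ℚ.+ a ℚ.* a) ℚ.* r
        ℚ.+ ℚ.- (3ℚ ℚ.+ 2ℚ ℚ.* a) ℚ.* (r ℚ.* r) ℚ.+ r ℚ.* r ℚ.* r) ℚ.*
        (r ℚ.* r ℚ.* r ℚ.+ ℚ.- (a ℚ.* (r ℚ.* r)) ℚ.+ ℚ.- ((a ℚ.+ 3ℚ) ℚ.* r) ℚ.+ ℚ.- 1ℚ)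
    lemma = solve 2 (λ a r → let s = :- con 2ℚ :+ :- (a :+ con 1ℚ) :* r :+ con 1ℚ :* (r :* r) in
      s :* s :* s :+ :- (a :* (s :* s)) :+ :- ((a :+ con 3ℚ) :* s) :+ :- con 1ℚ :=
      con 0ℚ :+ (con 3ℚ :+ con 2ℚ :* a :+ (con 3ℚ :* a :+ a :* a) :* r
        :+ :- (con 3ℚ :+ con 2ℚ :* a) :* (r :* r) :+ r :* r :* r) :*
        (r :* r :* r :+ :- (a :* (r :* r)) :+ :- ((a :+ con 3ℚ) :* r) :+ :- con 1ℚ)) refl
      where open ℚ-Solver

  -- The sum ρ + ρ′ + ρ″ = α is an identity of the coordinate expressions. Only the squares require
  -- the cubic, so the quotient is a multiple of `z`.
  tr≈conjugates : ∀ {ρ} → Root ρ → ∀ u →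
    ev ρ u + ev (ev ρ conj₁) u + ev (ev ρ conj₂) u ≈ fromℚ (tr u)
  tr≈conjugates {ρ} root ⟨ x , y , z ⟩ = ≈-mod
    (fromℚ z * (fromℚ 2ℚ * ρ + fromℚ (ℚ.- (2ℚ ℚ.+ 2ℚ ℚ.* α)))) root λ n → lemma α (seq ρ n) x y z
    where
    lemma : ∀ a r x y z →
      let s = a ℚ.+ 2ℚ ℚ.+ a ℚ.* r ℚ.+ ℚ.- 1ℚ ℚ.* (r ℚ.* r)
          t = ℚ.- 2ℚ ℚ.+ ℚ.- (a ℚ.+ 1ℚ) ℚ.* r ℚ.+ 1ℚ ℚ.* (r ℚ.* r)
      in
      x ℚ.+ y ℚ.* r ℚ.+ z ℚ.* (r ℚ.* r) ℚ.+ (x ℚ.+ y ℚ.* s ℚ.+ z ℚ.* (s ℚ.* s))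
        ℚ.+ (x ℚ.+ y ℚ.* t ℚ.+ z ℚ.* (t ℚ.* t)) ≡
      3ℚ ℚ.* x ℚ.+ a ℚ.* y ℚ.+ (a ℚ.* a ℚ.+ (a ℚ.+ 3ℚ ℚ.+ (a ℚ.+ 3ℚ))) ℚ.* z
        ℚ.+ z ℚ.* (2ℚ ℚ.* r ℚ.+ ℚ.- (2ℚ ℚ.+ 2ℚ ℚ.* a)) ℚ.*
        (r ℚ.* r ℚ.* r ℚ.+ ℚ.- (a ℚ.* (r ℚ.* r)) ℚ.+ ℚ.- ((a ℚ.+ 3ℚ) ℚ.* r) ℚ.+ ℚ.- 1ℚ)
    lemma = solve 5 (λ a r x y z →
      let s = a :+ con 2ℚ :+ a :* r :+ :- con 1ℚ :* (r :* r)
          t = :- con 2ℚ :+ :- (a :+ con 1ℚ) :* r :+ con 1ℚ :* (r :* r)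
      in
      x :+ y :* r :+ z :* (r :* r) :+ (x :+ y :* s :+ z :* (s :* s))
        :+ (x :+ y :* t :+ z :* (t :* t)) :=
      con 3ℚ :* x :+ a :* y :+ (a :* a :+ (a :+ con 3ℚ :+ (a :+ con 3ℚ))) :* z
        :+ z :* (con 2ℚ :* r :+ :- (con 2ℚ :+ con 2ℚ :* a)) :*
        (r :* r :* r :+ :- (a :* (r :* r)) :+ :- ((a :+ con 3ℚ) :* r) :+ :- con 1ℚ)) refl
      where open ℚ-Solver

  -- Total positivity in coordinates, with real roots in place of embeddings. Traces use it at ρ and
  -- its two conjugates.
  Pos : ℚ³ → Set
  Pos v = ∀ r → Root r → 0ℝ < ev r v

  tr-pos : ∀ {ρ} → Root ρ → ∀ v → Pos v → 0ℚ ℚ.< tr v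
  tr-pos {ρ} root v pos = fromℚ-pos (pos-resp-≈
    {ev ρ v + ev ρ₁ v + ev ρ₂ v} {fromℚ (tr v)} (tr≈conjugates root v)
    (pos-+ {ev ρ v + ev ρ₁ v} {ev ρ₂ v}
      (pos-+ {ev ρ v} {ev ρ₁ v} (pos ρ root) (pos ρ₁ (conj₁-root root))) (pos ρ₂ (conj₂-root root))))
    where
    ρ₁ ρ₂ : ℝ
    ρ₁ = ev ρ conj₁
    ρ₂ = ev ρ conj₂

  pos-⊗ : ∀ u v → Pos u → Pos v → Pos (u ⊗ v)
  pos-⊗ u v pu pv r root = pos-resp-≈ {ev r u * ev r v} {ev r (u ⊗ v)}
    (≈-sym (ev-⊗ root u v)) (pos-* {ev r u} {ev r v} (pu r root) (pv r root))

  pos-unit² : ∀ η η′ → η ⊗ η′ ≡ 1³ → Pos (η ⊗ η)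
  pos-unit² η η′ unit r root = pos-resp-≈ {ev r η * ev r η} {ev r (η ⊗ η)} (≈-sym (ev-⊗ root η η))
    (unit-square-pos {ev r η} {ev r η′}
      (≈-trans (≈-sym (ev-⊗ root η η′)) (≈-trans (ev-cong r unit) (ev-const r 1ℚ))))

  pos-ω : Pos ω³
  pos-ω r root = pos-resp-≈ {1ℝ + r + r * r} {ev r ω³} (≈-pointwise λ n → lemma (seq r n)) (1+x+x²-pos r)
    where
    lemma : ∀ r → 1ℚ ℚ.+ r ℚ.+ r ℚ.* r ≡ 1ℚ ℚ.+ 1ℚ ℚ.* r ℚ.+ 1ℚ ℚ.* (r ℚ.* r)
    lemma = solve 1 (λ r → con 1ℚ :+ r :+ r :* r := con 1ℚ :+ con 1ℚ :* r :+ con 1ℚ :* (r :* r)) refl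
      where open ℚ-Solver

  open ℚ-Solver using (Polynomial; solve; _:=_; _:+_; _:*_; _:-_; :-_; con)

  private
    Polynomial³ : ℕ → Set
    Polynomial³ n = Polynomial n × Polynomial n × Polynomial n

    -- The syntactic counterpart of `_⊗_`, whose evaluation reduces to it; the solver thus proves
    -- identities in coordinates without their expansions being written out.
    mulᵖ : ∀ {n} → Polynomial n → Polynomial³ n → Polynomial³ n → Polynomial³ n
    mulᵖ a (x , y , z) v =
      let shiftᵖ : Polynomial³ _ → Polynomial³ _
          shiftᵖ (x , y , z) = z , x :+ (a :+ con 3ℚ) :* z , y :+ a :* z
          v₀ , v₁ , v₂ = v
          v₀′ , v₁′ , v₂′ = shiftᵖ v
          v₀″ , v₁″ , v₂″ = shiftᵖ (shiftᵖ v)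
      in x :* v₀ :+ y :* v₀′ :+ z :* v₀″ , x :* v₁ :+ y :* v₁′ :+ z :* v₁″ , x :* v₂ :+ y :* v₂′ :+ z :* v₂″

    trace : ∀ {n} → Polynomial n → Polynomial³ n → Polynomial n
    trace a (x , y , z) = con 3ℚ :* x :+ a :* y :+ (a :* a :+ ((a :+ con 3ℚ) :+ (a :+ con 3ℚ))) :* z

    constant : ∀ {n} → ℚ³ → Polynomial³ n
    constant ⟨ x , y , z ⟩ = con x , con y , con z

    π₀ π₁ π₂ : ∀ {n} → Polynomial³ n → Polynomial n
    π₀ (x , _ , _) = x
    π₁ (_ , y , _) = y
    π₂ (_ , _ , z) = z

  pos-1 : Pos 1³
  pos-1 r _ = pos-resp-≈ {1ℝ} {ev r 1³} (≈-sym (ev-const r 1ℚ))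
    (0<⇒< {1ℝ} (½ , 0<½ , 0 , λ _ _ → ℚ.*<* (ℤ.+<+ (ℕ.s≤s (ℕ.s≤s ℕ.z≤n)))))

  pos-ρ² : Pos e₂
  pos-ρ² = subst Pos (⟨⟩-cong
      (solve 1 (λ a → π₀ (mulᵖ a (constant e₁) (constant e₁)) := con 0ℚ) refl α)
      (solve 1 (λ a → π₁ (mulᵖ a (constant e₁) (constant e₁)) := con 0ℚ) refl α)
      (solve 1 (λ a → π₂ (mulᵖ a (constant e₁) (constant e₁)) := con 1ℚ) refl α))
    -- The cubic says ρ(ρ² - aρ - (a + 3)) = 1.
    (pos-unit² e₁ ⟨ ℚ.- (α ℚ.+ 3ℚ) , ℚ.- α , 1ℚ ⟩ (⟨⟩-cong
      (solve 1 (λ a → π₀ (mulᵖ a (constant e₁) (ρ⁻¹ a)) := con 1ℚ) refl α)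
      (solve 1 (λ a → π₁ (mulᵖ a (constant e₁) (ρ⁻¹ a)) := con 0ℚ) refl α)
      (solve 1 (λ a → π₂ (mulᵖ a (constant e₁) (ρ⁻¹ a)) := con 0ℚ) refl α)))
    where
    ρ⁻¹ : Polynomial 1 → Polynomial³ 1
    ρ⁻¹ a = :- (a :+ con 3ℚ) , :- a , con 1ℚ

  pos-[1+ρ]² : Pos ⟨ 1ℚ , 2ℚ , 1ℚ ⟩
  pos-[1+ρ]² = subst Pos (⟨⟩-cong
      (solve 1 (λ a → π₀ (mulᵖ a (constant 1+ρ) (constant 1+ρ)) := con 1ℚ) refl α)
      (solve 1 (λ a → π₁ (mulᵖ a (constant 1+ρ) (constant 1+ρ)) := con 2ℚ) refl α)
      (solve 1 (λ a → π₂ (mulᵖ a (constant 1+ρ) (constant 1+ρ)) := con 1ℚ) refl α))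
    -- The cubic takes the value 1 at -1: it equals (x + 1)(x² - (a + 1)x - 2) + 1, which gives the
    -- inverse of 1 + ρ.
    (pos-unit² 1+ρ ⟨ 2ℚ , α ℚ.+ 1ℚ , ℚ.- 1ℚ ⟩ (⟨⟩-cong
      (solve 1 (λ a → π₀ (mulᵖ a (constant 1+ρ) ([1+ρ]⁻¹ a)) := con 1ℚ) refl α)
      (solve 1 (λ a → π₁ (mulᵖ a (constant 1+ρ) ([1+ρ]⁻¹ a)) := con 0ℚ) refl α)
      (solve 1 (λ a → π₂ (mulᵖ a (constant 1+ρ) ([1+ρ]⁻¹ a)) := con 0ℚ) refl α)))
    where
    [1+ρ]⁻¹ : Polynomial 1 → Polynomial³ 1
    [1+ρ]⁻¹ a = con 2ℚ , a :+ con 1ℚ , :- con 1ℚ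

  2tr-ω : ∀ v → 2ℚ ℚ.* tr (ω³ ⊗ v) ≡ tr (1³ ⊗ v) ℚ.+ tr (e₂ ⊗ v) ℚ.+ tr (⟨ 1ℚ , 2ℚ , 1ℚ ⟩ ⊗ v)
  2tr-ω ⟨ x , y , z ⟩ = solve 4 (λ a x y z →
    let T : ℚ³ → Polynomial 4
        T u = trace a (mulᵖ a (constant u) (x , y , z))
    in con 2ℚ :* T ω³ := T 1³ :+ T e₂ :+ T ⟨ 1ℚ , 2ℚ , 1ℚ ⟩) refl α x y z

  -- The element 1/ω² and its trace functional

  Δ : ℚ
  Δ = α ℚ.* α ℚ.+ 3ℚ ℚ.* α ℚ.+ ι (ℤ.+ 9)

  0<Δ : 0ℚ ℚ.< Δ
  0<Δ = subst (0ℚ ℚ.<_) (solve 1 (λ a →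
      con (ℤ.+ 27 ℚ./ 4) :+ (a :+ con (ℤ.+ 3 ℚ./ 2)) :* (a :+ con (ℤ.+ 3 ℚ./ 2)) :=
      a :* a :+ con 3ℚ :* a :+ con (ι (ℤ.+ 9))) refl α)
    (ℚ.+-mono-<-≤ (ℚ.positive⁻¹ (ℤ.+ 27 ℚ./ 4)) (square≥0 (α ℚ.+ ℤ.+ 3 ℚ./ 2)))

  Δ⁻¹ : ℚ
  Δ⁻¹ = proj₁ (recip 0<Δ)

  ΔΔ⁻¹≡1 : Δ⁻¹ ℚ.* Δ ≡ 1ℚ
  ΔΔ⁻¹≡1 = trans (ℚ.*-comm Δ⁻¹ Δ) (proj₂ (proj₂ (recip 0<Δ)))

  -- δ = 1/ω², with denominator Δ = N(ω).
  Δδ³ δ³ : ℚ³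
  Δδ³ = ⟨ α ℚ.* α ℚ.+ ι (ℤ.+ 5) ℚ.* α ℚ.+ ι (ℤ.+ 16) , ι (ℤ.+ 4) ℚ.* α ℚ.+ 1ℚ , ι (ℤ.- ℤ.+ 5) ⟩
  δ³ = Δ⁻¹ ∙ Δδ³

  private
    Δδᵖ : ∀ {n} → Polynomial n → Polynomial³ n
    Δδᵖ a = a :* a :+ con (ι (ℤ.+ 5)) :* a :+ con (ι (ℤ.+ 16)) , con (ι (ℤ.+ 4)) :* a :+ con 1ℚ , con (ι (ℤ.- ℤ.+ 5))

    Δᵖ : ∀ {n} → Polynomial n → Polynomial n
    Δᵖ a = a :* a :+ con 3ℚ :* a :+ con (ι (ℤ.+ 9))

  -- The conjugates of ω are ω/ρ² and ω/(1 + ρ)², so Δ = ω³/(ρ(1 + ρ))². Hence Δ/ω² = ω/(ρ(1 + ρ))²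
  -- is integral, which is why the single factor Δ clears the denominators.
  δω²≡1 : δ³ ⊗ (ω³ ⊗ ω³) ≡ 1³
  δω²≡1 = trans (∙-⊗ Δ⁻¹ Δδ³ (ω³ ⊗ ω³)) (trans
    (cong (Δ⁻¹ ∙_) (⟨⟩-cong
      (solve 1 (λ a → π₀ (product a) := Δᵖ a) refl α)
      (solve 1 (λ a → π₁ (product a) := con 0ℚ) refl α)
      (solve 1 (λ a → π₂ (product a) := con 0ℚ) refl α)))
    (⟨⟩-cong ΔΔ⁻¹≡1 (ℚ.*-zeroʳ Δ⁻¹) (ℚ.*-zeroʳ Δ⁻¹)))
    where
    product : Polynomial 1 → Polynomial³ 1
    product a = mulᵖ a (Δδᵖ a) (mulᵖ a (constant ω³) (constant ω³))

  tr-∙ : ∀ s u → tr (s ∙ u) ≡ s ℚ.* tr u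
  tr-∙ s ⟨ x , y , z ⟩ = solve 5 (λ a s x y z →
    trace a (s :* x , s :* y , s :* z) := s :* trace a (x , y , z)) refl α s x y z

  -- By Euler's formula the trace of w divided by the derivative of the cubic at ρ is the
  -- ρ²-coefficient of w. As δ is 1/(ρ(1 + ρ)) over that derivative, the coefficients 2, -1, 1 of
  -- `φ` are the ρ²-coefficients of 1, ρ, ρ² divided by ρ(1 + ρ). The solver verifies the identity
  -- multiplied by Δ.
  tr-δ : ∀ v → tr (δ³ ⊗ v) ≡ φ v
  tr-δ v@(⟨ x , y , z ⟩) = begin
    tr (δ³ ⊗ v)             ≡⟨ cong tr (∙-⊗ Δ⁻¹ Δδ³ v) ⟩
    tr (Δ⁻¹ ∙ (Δδ³ ⊗ v))    ≡⟨ tr-∙ Δ⁻¹ (Δδ³ ⊗ v) ⟩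
    Δ⁻¹ ℚ.* tr (Δδ³ ⊗ v)    ≡⟨ cong (Δ⁻¹ ℚ.*_) (solve 4 (λ a x y z →
      trace a (mulᵖ a (Δδᵖ a) (x , y , z)) := Δᵖ a :* (con 2ℚ :* x :- y :+ z)) refl α x y z) ⟩
    Δ⁻¹ ℚ.* (Δ ℚ.* φ v)     ≡⟨ ℚ.*-assoc Δ⁻¹ Δ (φ v) ⟨
    Δ⁻¹ ℚ.* Δ ℚ.* φ v       ≡⟨ cong (ℚ._* φ v) ΔΔ⁻¹≡1 ⟩
    1ℚ ℚ.* φ v              ≡⟨ ℚ.*-identityˡ (φ v) ⟩
    φ v                     ∎
    where open ≡-Reasoning

  pos-δ : Pos δ³
  pos-δ r root = pos-cofactor (ev r δ³) (ev r (ω³ ⊗ ω³))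
    (≈-trans (≈-sym (ev-⊗ root δ³ (ω³ ⊗ ω³))) (≈-trans (ev-cong r δω²≡1) (ev-const r 1ℚ)))
    (pos-⊗ ω³ ω³ pos-ω pos-ω r root)

  φ-pos : ∀ {ρ} → Root ρ → ∀ v → Pos v → 0ℚ ℚ.< φ v
  φ-pos root v pos = subst (0ℚ ℚ.<_) (tr-δ v) (tr-pos root (δ³ ⊗ v) (pos-⊗ δ³ v pos-δ pos))

  φ-ρ² : ∀ v → φ (e₂ ⊗ v) ≡ c₀ v ℚ.- c₁ v ℚ.+ 2ℚ ℚ.* c₂ v
  φ-ρ² ⟨ x , y , z ⟩ = solve 4 (λ a x y z →
    let u = mulᵖ a (constant e₂) (x , y , z)
    in con 2ℚ :* π₀ u :- π₁ u :+ π₂ u := x :- y :+ con 2ℚ :* z) refl α x y z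

  φ-[1+ρ]² : ∀ v → φ (⟨ 1ℚ , 2ℚ , 1ℚ ⟩ ⊗ v) ≡ c₀ v ℚ.+ c₂ v
  φ-[1+ρ]² ⟨ x , y , z ⟩ = solve 4 (λ a x y z →
    let u = mulᵖ a (constant ⟨ 1ℚ , 2ℚ , 1ℚ ⟩) (x , y , z)
    in con 2ℚ :* π₀ u :- π₁ u :+ π₂ u := x :+ z) refl α x y z

-- The codifferent and the theorem

record ℤ³ : Set where
  constructor ⟨_,_,_⟩
  field
    z₀ z₁ z₂ : ℤ

open ℤ³

ι³ : ℤ³ → ℚ³
ι³ ⟨ i , j , k ⟩ = ⟨ ι i , ι j , ι k ⟩

-- Integral forms of v ↦ φ(v), φ(ρ²v) and φ((1 + ρ)²v). The parameter a cancels in the last two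
-- because β - α = 3.
φ₁ φ₂ φ₃ : ℤ³ → ℤ
φ₁ ⟨ i , j , k ⟩ = ℤ.+ 2 ℤ.* i ℤ.- j ℤ.+ k
φ₂ ⟨ i , j , k ⟩ = i ℤ.- j ℤ.+ ℤ.+ 2 ℤ.* k
φ₃ ⟨ i , j , k ⟩ = i ℤ.+ k

ι-minus : ∀ i j → ι (i ℤ.- j) ≡ ι i ℚ.- ι j
ι-minus i j = trans (ι-+ i (ℤ.- j)) (cong (ι i ℚ.+_) (ι-neg j))

ι-φ₁ : ∀ u → ι (φ₁ u) ≡ φ (ι³ u)
ι-φ₁ ⟨ i , j , k ⟩ = trans (ι-+ (ℤ.+ 2 ℤ.* i ℤ.- j) k)
  (cong (ℚ._+ ι k) (trans (ι-minus (ℤ.+ 2 ℤ.* i) j) (cong (ℚ._- ι j) (ι-* (ℤ.+ 2) i))))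

ι-φ₂ : ∀ u → ι (φ₂ u) ≡ c₀ (ι³ u) ℚ.- c₁ (ι³ u) ℚ.+ 2ℚ ℚ.* c₂ (ι³ u)
ι-φ₂ ⟨ i , j , k ⟩ = trans (ι-+ (i ℤ.- j) (ℤ.+ 2 ℤ.* k)) (cong₂ ℚ._+_ (ι-minus i j) (ι-* (ℤ.+ 2) k))

0<⇒1≤ : ∀ {m} → 0ℤ ℤ.< m → 1ℤ ℤ.≤ m
0<⇒1≤ = ℤ.i<j⇒suc[i]≤j

pos+pos≡2⇒≡1 : ∀ m n → 0ℤ ℤ.< m → 0ℤ ℤ.< n → m ℤ.+ n ≡ ℤ.+ 2 → m ≡ 1ℤ
pos+pos≡2⇒≡1 m n 0<m 0<n m+n≡2 = ℤ.≤-antisym m≤1 (0<⇒1≤ 0<m)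
  where
  open ℤ.≤-Reasoning
  m≤1 : m ℤ.≤ 1ℤ
  m≤1 = begin
    m                 ≡⟨ solve 2 (λ m n → m := (m :+ n) :- n) refl m n ⟩
    m ℤ.+ n ℤ.- n     ≡⟨ cong (ℤ._- n) m+n≡2 ⟩
    ℤ.+ 2 ℤ.- n       ≤⟨ ℤ.+-monoʳ-≤ (ℤ.+ 2) (ℤ.neg-mono-≤ (0<⇒1≤ 0<n)) ⟩
    1ℤ                ∎
    where open ℤ-Solver.+-*-Solver

2*i≢1 : ∀ i → ℤ.+ 2 ℤ.* i ≢ 1ℤ
2*i≢1 i eq = contradiction (trans (sym (parity-* (ℤ.+ 2) i)) (cong parity eq)) λ ()

-- The sum is at least 3, and integrality of t rounds 3/2 up to 2.
2≤[m+n+o]/2 : ∀ {m n o t} → 0ℤ ℤ.< m → 0ℤ ℤ.< n → 0ℤ ℤ.< o →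
  ℤ.+ 2 ℤ.* t ≡ m ℤ.+ n ℤ.+ o → ℤ.+ 2 ℤ.≤ t
2≤[m+n+o]/2 {m} {n} {o} {t} 0<m 0<n 0<o eq = ℤ.≮⇒≥ λ t<2 → ℤ.<-irrefl refl (begin-strict
  ℤ.+ 2               <⟨ ℤ.+<+ (ℕ.n<1+n 2) ⟩
  ℤ.+ 3               ≤⟨ ℤ.+-mono-≤ (ℤ.+-mono-≤ (0<⇒1≤ 0<m) (0<⇒1≤ 0<n)) (0<⇒1≤ 0<o) ⟩
  m ℤ.+ n ℤ.+ o       ≡⟨ eq ⟨
  ℤ.+ 2 ℤ.* t         ≤⟨ ℤ.*-monoˡ-≤-nonNeg (ℤ.+ 2) (ℤ.i<j⇒i≤pred[j] t<2) ⟩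
  ℤ.+ 2               ∎)
  where open ℤ.≤-Reasoning

-- 2i = φ₁ + φ₃ - φ₂, and each functional takes the value 2 at ω.
no-splitting : ∀ u v → ι³ u ⊕ ι³ v ≡ ω³ →
  0ℤ ℤ.< φ₁ u → 0ℤ ℤ.< φ₂ u → 0ℤ ℤ.< φ₃ u → 0ℤ ℤ.< φ₁ v → 0ℤ ℤ.< φ₂ v → 0ℤ ℤ.< φ₃ v → ⊥
no-splitting ⟨ i , j , k ⟩ ⟨ i′ , j′ , k′ ⟩ u+v≡ω p₁ p₂ p₃ q₁ q₂ q₃ = 2*i≢1 i (begin
  ℤ.+ 2 ℤ.* i                        ≡⟨ solve 3 (λ i j k → con (ℤ.+ 2) :* i :=
    (con (ℤ.+ 2) :* i :- j :+ k) :+ (i :+ k) :- (i :- j :+ con (ℤ.+ 2) :* k)) refl i j k ⟩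
  φ₁ u ℤ.+ φ₃ u ℤ.- φ₂ u             ≡⟨ cong₂ ℤ._-_ (cong₂ ℤ._+_
    (one (φ₁ u) (φ₁ v) p₁ q₁ (trans
      (solve 6 (λ i j k i′ j′ k′ → (con (ℤ.+ 2) :* i :- j :+ k) :+ (con (ℤ.+ 2) :* i′ :- j′ :+ k′) :=
        con (ℤ.+ 2) :* (i :+ i′) :- (j :+ j′) :+ (k :+ k′)) refl i j k i′ j′ k′)
      (cong₂ ℤ._+_ (cong₂ ℤ._-_ (cong (ℤ.+ 2 ℤ.*_) i+i′) j+j′) k+k′)))
    (one (φ₃ u) (φ₃ v) p₃ q₃ (trans
      (solve 4 (λ i k i′ k′ → (i :+ k) :+ (i′ :+ k′) := (i :+ i′) :+ (k :+ k′)) refl i k i′ k′)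
      (cong₂ ℤ._+_ i+i′ k+k′))))
    (one (φ₂ u) (φ₂ v) p₂ q₂ (trans
      (solve 6 (λ i j k i′ j′ k′ → (i :- j :+ con (ℤ.+ 2) :* k) :+ (i′ :- j′ :+ con (ℤ.+ 2) :* k′) :=
        (i :+ i′) :- (j :+ j′) :+ con (ℤ.+ 2) :* (k :+ k′)) refl i j k i′ j′ k′)
      (cong₂ ℤ._+_ (cong₂ ℤ._-_ i+i′ j+j′) (cong (ℤ.+ 2 ℤ.*_) k+k′)))) ⟩
  1ℤ                                 ∎)
  where
  open ≡-Reasoning
  open ℤ-Solver.+-*-Solver
  one : ∀ m n → 0ℤ ℤ.< m → 0ℤ ℤ.< n → m ℤ.+ n ≡ ℤ.+ 2 → m ≡ 1ℤ
  one = pos+pos≡2⇒≡1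
  u v : ℤ³
  u = ⟨ i , j , k ⟩
  v = ⟨ i′ , j′ , k′ ⟩
  i+i′ : i ℤ.+ i′ ≡ 1ℤ
  i+i′ = ι-injective (trans (ι-+ i i′) (cong c₀ u+v≡ω))
  j+j′ : j ℤ.+ j′ ≡ 1ℤ
  j+j′ = ι-injective (trans (ι-+ j j′) (cong c₁ u+v≡ω))
  k+k′ : k ℤ.+ k′ ≡ 1ℤ
  k+k′ = ι-injective (trans (ι-+ k k′) (cong c₂ u+v≡ω))

module Main (a : ℤ) (ρ : ℝ) (ρ-root : Cubic.Root a ρ) where
  open NumberField ρ
  open Cubic a
  open Trace a
  open Positivity a
  open Field a ρ ρ-root

  -- Horner's scheme with `shift`, which preserves integrality because the cubic is monic with
  -- integer coefficients.
  eval-integral : ∀ p → ∃[ u ] eval p ρ ≈ ev ρ (ι³ u)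
  eval-integral [] = ⟨ 0ℤ , 0ℤ , 0ℤ ⟩ , ≈-sym (ev-const ρ 0ℚ)
  eval-integral (c ∷ p) =
    let u@(⟨ i , j , k ⟩) , eq = eval-integral p
        b = a ℤ.+ ℤ.+ 3
    in ⟨ c ℤ.+ k , i ℤ.+ b ℤ.* k , j ℤ.+ a ℤ.* k ⟩ , (begin
      fromℤ c + ρ * eval p ρ
        ≈⟨ +-cong (≈-sym (ev-const ρ (ι c))) (≈-trans (*-cong ≈-refl eq) (≈-sym (ev-shift ρ-root (ι³ u)))) ⟩
      ev ρ ⟨ ι c , 0ℚ , 0ℚ ⟩ + ev ρ (shift (ι³ u))
        ≈⟨ ev-⊕ ρ ⟨ ι c , 0ℚ , 0ℚ ⟩ (shift (ι³ u)) ⟨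
      ev ρ (⟨ ι c , 0ℚ , 0ℚ ⟩ ⊕ shift (ι³ u))
        ≈⟨ ev-cong ρ (⟨⟩-cong (sym (ι-+ c k))
             (trans (ℚ.+-identityˡ _) (sym (trans (ι-+ i (b ℤ.* k)) (cong (ι i ℚ.+_)
               (trans (ι-* b k) (cong (ℚ._* ι k) (ι-+ a (ℤ.+ 3))))))))
             (trans (ℚ.+-identityˡ _) (sym (trans (ι-+ j (a ℤ.* k)) (cong (ι j ℚ.+_) (ι-* a k)))))) ⟩
      ev ρ (ι³ ⟨ c ℤ.+ k , i ℤ.+ b ℤ.* k , j ℤ.+ a ℤ.* k ⟩) ∎)
    where open ≈-Reasoning

  integral-∈ℤ[ρ] : ∀ u → evᴷ (ι³ u) ∈ ℤ[ρ]
  integral-∈ℤ[ρ] ⟨ i , j , k ⟩ = i ∷ j ∷ k ∷ [] , unwrap (≈-pointwise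
    {ev ρ ⟨ ι i , ι j , ι k ⟩} {eval (i ∷ j ∷ k ∷ []) ρ} λ n → lemma (seq ρ n) (ι i) (ι j) (ι k))
    where
    lemma : ∀ r x y z → x ℚ.+ y ℚ.* r ℚ.+ z ℚ.* (r ℚ.* r) ≡ x ℚ.+ r ℚ.* (y ℚ.+ r ℚ.* (z ℚ.+ r ℚ.* 0ℚ))
    lemma = solve 4 (λ r x y z →
      x :+ y :* r :+ z :* (r :* r) := x :+ r :* (y :+ r :* (z :+ r :* con 0ℚ))) refl
      where open ℚ-Solver

  ω : K
  ω = 1ᴷ +ᴷ ρᴷ +ᴷ ρᴷ *ᴷ ρᴷ

  value-ω : value ω ≈ ev ρ ω³
  value-ω = ≈-pointwise λ n → lemma (seq ρ n)
    where
    lemma : ∀ r → 1ℚ ℚ.+ r ℚ.+ r ℚ.* r ≡ 1ℚ ℚ.+ 1ℚ ℚ.* r ℚ.+ 1ℚ ℚ.* (r ℚ.* r)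
    lemma = solve 1 (λ r → con 1ℚ :+ r :+ r :* r := con 1ℚ :+ con 1ℚ :* r :+ con 1ℚ :* (r :* r)) refl
      where open ℚ-Solver

  module RealEmbedding (σ : K → ℝ) (isEmbedding : IsRealEmbedding σ) where
    open RingMorphisms K-rawRing ℝ-rawRing
    open IsRingMonomorphism isEmbedding

    σ-cong : ∀ {x y} → value x ≈ value y → σ x ≈ σ y
    σ-cong {x} {y} (wrap eq) = wrap (⟦⟧-cong {x} {y} eq)

    σ-+ : ∀ x y → σ (x +ᴷ y) ≈ σ x + σ y
    σ-+ x y = wrap (+-homo x y)

    σ-* : ∀ x y → σ (x *ᴷ y) ≈ σ x * σ y
    σ-* x y = wrap (*-homo x y)

    σ-1 : σ 1ᴷ ≈ 1ℝ
    σ-1 = wrap 1#-homo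

  -- The homomorphism laws give σ(ω) = 1 + σ(ρ) + σ(ρ)², which is positive whatever real number σ(ρ)
  -- is.
  ω-totallyPositive : TotallyPositive ω
  ω-totallyPositive σ isEmbedding = pos-resp-≈ {1ℝ + σ ρᴷ + σ ρᴷ * σ ρᴷ} {σ ω}
    (≈-sym (≈-trans (σ-+ (1ᴷ +ᴷ ρᴷ) (ρᴷ *ᴷ ρᴷ))
      (+-cong (≈-trans (σ-+ 1ᴷ ρᴷ) (+-cong σ-1 ≈-refl)) (σ-* ρᴷ ρᴷ)))) (1+x+x²-pos (σ ρᴷ))
    where open RealEmbedding σ isEmbedding

  δ : K
  δ = evᴷ δ³

  δ-totallyPositive : TotallyPositive δ
  δ-totallyPositive σ isEmbedding = pos-cofactor (σ δ) (σ ω * σ ω)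
    (begin
      σ δ * (σ ω * σ ω)    ≈⟨ *-cong ≈-refl (σ-* ω ω) ⟨
      σ δ * σ (ω *ᴷ ω)     ≈⟨ σ-* δ (ω *ᴷ ω) ⟨
      σ (δ *ᴷ (ω *ᴷ ω))    ≈⟨ σ-cong {δ *ᴷ (ω *ᴷ ω)} {1ᴷ} δω² ⟩
      σ 1ᴷ                 ≈⟨ σ-1 ⟩
      1ℝ                   ∎)
    (pos-* {σ ω} {σ ω} 0<σω 0<σω)
    where
    open RealEmbedding σ isEmbedding
    open ≈-Reasoning
    0<σω : 0ℝ < σ ω
    0<σω = ω-totallyPositive σ isEmbedding
    δω² : value (δ *ᴷ (ω *ᴷ ω)) ≈ 1ℝ
    δω² = begin
      ev ρ δ³ * (value ω * value ω)    ≈⟨ *-cong ≈-refl (*-cong value-ω value-ω) ⟩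
      ev ρ δ³ * (ev ρ ω³ * ev ρ ω³)    ≈⟨ *-cong ≈-refl (ev-⊗ ρ-root ω³ ω³) ⟨
      ev ρ δ³ * ev ρ (ω³ ⊗ ω³)         ≈⟨ ev-⊗ ρ-root δ³ (ω³ ⊗ ω³) ⟨
      ev ρ (δ³ ⊗ (ω³ ⊗ ω³))            ≈⟨ ev-cong ρ δω²≡1 ⟩
      ev ρ 1³                          ≈⟨ ev-const ρ 1ℚ ⟩
      1ℝ                               ∎

  -- The hypothesis is applied to the embedding ρ ↦ r, available for every root r.
  totallyPositive⇒pos : ∀ x {v} → value x ≈ ev ρ v → TotallyPositive x → Pos v
  totallyPositive⇒pos x {v} x≈ pos r root =
    subst (λ u → 0ℝ < ev r u) (coord-unique x x≈) (pos (embedding r) (embedding-isRealEmbedding root))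

  δ-hasTrace : ∀ x v → value x ≈ ev ρ v → HasTrace (x *ᴷ δ) (φ v)
  δ-hasTrace x v x≈ = subst (HasTrace (x *ᴷ δ)) (tr-δ v) (tr⇒hasTrace (x *ᴷ δ) (begin
    -- The factors are exchanged in ℝ because `tr-δ` has `δ³` on the left.
    value x * ev ρ δ³    ≈⟨ ≈-pointwise (λ n → ℚ.*-comm (seq (value x) n) (seq (ev ρ δ³) n)) ⟩
    ev ρ δ³ * value x    ≈⟨ *-cong ≈-refl x≈ ⟩
    ev ρ δ³ * ev ρ v     ≈⟨ ev-⊗ ρ-root δ³ v ⟨
    ev ρ (δ³ ⊗ v)        ∎))
    where open ≈-Reasoning

  φ₁-pos : ∀ u → Pos (ι³ u) → 0ℤ ℤ.< φ₁ u
  φ₁-pos u pos = ι-cancel-< (subst (0ℚ ℚ.<_) (sym (ι-φ₁ u)) (φ-pos ρ-root (ι³ u) pos))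

  φ₂-pos : ∀ u → Pos (ι³ u) → 0ℤ ℤ.< φ₂ u
  φ₂-pos u pos = ι-cancel-< (subst (0ℚ ℚ.<_) (trans (φ-ρ² (ι³ u)) (sym (ι-φ₂ u)))
    (φ-pos ρ-root (e₂ ⊗ ι³ u) (pos-⊗ e₂ (ι³ u) pos-ρ² pos)))

  φ₃-pos : ∀ u → Pos (ι³ u) → 0ℤ ℤ.< φ₃ u
  φ₃-pos u pos = ι-cancel-< (subst (0ℚ ℚ.<_) (trans (φ-[1+ρ]² (ι³ u)) (sym (ι-+ (z₀ u) (z₂ u))))
    (φ-pos ρ-root (⟨ 1ℚ , 2ℚ , 1ℚ ⟩ ⊗ ι³ u) (pos-⊗ ⟨ 1ℚ , 2ℚ , 1ℚ ⟩ (ι³ u) pos-[1+ρ]² pos)))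

  module _ (𝒪⇔ℤ[ρ] : ∀ x → x ∈ 𝒪 ⇔ x ∈ ℤ[ρ]) where

    integral-coordinates : ∀ x → x ∈ 𝒪 → ∃[ u ] value x ≈ ev ρ (ι³ u)
    integral-coordinates x x∈𝒪 =
      let p , x≃p = Equivalence.to (𝒪⇔ℤ[ρ] x) x∈𝒪
          u , p≈u = eval-integral p
      in u , ≈-trans {y = eval p ρ} (wrap x≃p) p≈u

    -- Supplies the integers against which an element of the codifferent is tested.
    integral-∈𝒪 : ∀ u → evᴷ (ι³ u) ∈ 𝒪
    integral-∈𝒪 u = Equivalence.from (𝒪⇔ℤ[ρ] (evᴷ (ι³ u))) (integral-∈ℤ[ρ] u)

    ω∈𝒪 : ω ∈ 𝒪
    ω∈𝒪 = Equivalence.from (𝒪⇔ℤ[ρ] ω) (let p , eq = integral-∈ℤ[ρ] ⟨ 1ℤ , 1ℤ , 1ℤ ⟩ in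
      p , unwrap (≈-trans {y = ev ρ ω³} {z = eval p ρ} value-ω (wrap eq)))

    ω-indecomposable : Indecomposable ω
    ω-indecomposable = (ω∈𝒪 , ω-totallyPositive) ,
      λ (y , z , (y∈𝒪 , 0<y) , (z∈𝒪 , 0<z) , ω≃y+z) →
        let u , y≈ = integral-coordinates y y∈𝒪
            v , z≈ = integral-coordinates z z∈𝒪
            pu = totallyPositive⇒pos y y≈ 0<y
            pv = totallyPositive⇒pos z z≈ 0<z
        in no-splitting u v (ev-injective ρ-root (ι³ u ⊕ ι³ v) ω³ (≈-trans (ev-⊕ ρ (ι³ u) (ι³ v))
             (≈-trans (+-cong (≈-sym y≈) (≈-sym z≈))
               (≈-trans {y = value ω} (≈-sym (wrap ω≃y+z)) value-ω))))
             (φ₁-pos u pu) (φ₂-pos u pu) (φ₃-pos u pu) (φ₁-pos v pv) (φ₂-pos v pv) (φ₃-pos v pv)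

    δ∈𝒪^∨⁺ : δ ∈ 𝒪^∨⁺
    δ∈𝒪^∨⁺ = (λ x x∈𝒪 → let u , x≈ = integral-coordinates x x∈𝒪 in
      φ₁ u , subst (HasTrace (x *ᴷ δ)) (sym (ι-φ₁ u)) (δ-hasTrace x (ι³ u) x≈)) , δ-totallyPositive

    -- Membership in 𝒪^∨ yields an integral trace with respect to some unspecified basis; invariance
    -- of the trace identifies it with the explicit `tr`.
    codifferent-trace : ∀ γ → γ ∈ 𝒪^∨ → ∀ u → ∃[ z ] ι z ≡ tr (ι³ u ⊗ coord γ)
    codifferent-trace γ γ∈ u = let z , hasTrace = γ∈ (evᴷ (ι³ u)) (integral-∈𝒪 u) in
      z , hasTrace⇒tr (evᴷ (ι³ u) *ᴷ γ)
        (≈-trans (*-cong ≈-refl (value≈ γ)) (≈-sym (ev-⊗ ρ-root (ι³ u) (coord γ)))) hasTrace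

    trace-bound : ∀ t → ∃[ γ ] (γ ∈ 𝒪^∨⁺ × HasTrace (ω *ᴷ γ) t) → ℤ.+ 2 / 1 ℚ.≤ t
    trace-bound t (γ , (γ∈𝒪^∨ , 0<γ) , hasTrace) =
      let v = coord γ
          pv = totallyPositive⇒pos γ (value≈ γ) 0<γ
          t≡ = hasTrace⇒tr (ω *ᴷ γ) {u = ω³ ⊗ v}
            (≈-trans (*-cong value-ω (value≈ γ)) (≈-sym (ev-⊗ ρ-root ω³ v))) hasTrace
          -- The integral traces of γ against ω, 1, ρ² and (1 + ρ)², in this order.
          z , z≡ = codifferent-trace γ γ∈𝒪^∨ ⟨ 1ℤ , 1ℤ , 1ℤ ⟩
          l , l≡ = codifferent-trace γ γ∈𝒪^∨ ⟨ 1ℤ , 0ℤ , 0ℤ ⟩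
          m , m≡ = codifferent-trace γ γ∈𝒪^∨ ⟨ 0ℤ , 0ℤ , 1ℤ ⟩
          n , n≡ = codifferent-trace γ γ∈𝒪^∨ ⟨ 1ℤ , ℤ.+ 2 , 1ℤ ⟩
          positive : ∀ u {k} → Pos u → ι k ≡ tr (u ⊗ v) → 0ℤ ℤ.< k
          positive u pu k≡ = ι-cancel-< (subst (0ℚ ℚ.<_) (sym k≡) (tr-pos ρ-root (u ⊗ v) (pos-⊗ u v pu pv)))
          2z≡l+m+n : ℤ.+ 2 ℤ.* z ≡ l ℤ.+ m ℤ.+ n
          2z≡l+m+n = ι-injective (begin
            ι (ℤ.+ 2 ℤ.* z)            ≡⟨ ι-* (ℤ.+ 2) z ⟩
            2ℚ ℚ.* ι z                 ≡⟨ cong (2ℚ ℚ.*_) z≡ ⟩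
            2ℚ ℚ.* tr (ω³ ⊗ v)         ≡⟨ 2tr-ω v ⟩
            tr (1³ ⊗ v) ℚ.+ tr (e₂ ⊗ v) ℚ.+ tr (⟨ 1ℚ , 2ℚ , 1ℚ ⟩ ⊗ v)
              ≡⟨ cong₂ ℚ._+_ (cong₂ ℚ._+_ l≡ m≡) n≡ ⟨
            ι l ℚ.+ ι m ℚ.+ ι n        ≡⟨ cong (ℚ._+ ι n) (ι-+ l m) ⟨
            ι (l ℤ.+ m) ℚ.+ ι n        ≡⟨ ι-+ (l ℤ.+ m) n ⟨
            ι (l ℤ.+ m ℤ.+ n)          ∎)
      in subst (ι (ℤ.+ 2) ℚ.≤_) (trans z≡ (sym t≡)) (ι-mono-≤ {ℤ.+ 2} {z} (2≤[m+n+o]/2 {l} {m} {n}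
           (positive 1³ pos-1 l≡) (positive e₂ pos-ρ² m≡) (positive ⟨ 1ℚ , 2ℚ , 1ℚ ⟩ pos-[1+ρ]² n≡) 2z≡l+m+n))
      where open ≡-Reasoning

lemma5p2 : (a : ℤ) → -1ℤ ℤ.≤ a →
    (ρ : ℝ) → IsLargestRoot (simplestCubic a) ρ →
    let open NumberField ρ
        ω = 1ᴷ +ᴷ ρᴷ +ᴷ ρᴷ *ᴷ ρᴷ
    in
    (∀ x → x ∈ 𝒪 ⇔ x ∈ ℤ[ρ]) →
    Indecomposable ω ×
    IsMinimum (λ t → ∃[ δ ] (δ ∈ 𝒪^∨⁺ × HasTrace (ω *ᴷ δ) t)) (ℤ.+ 2 / 1)
lemma5p2 a _ ρ (ρ-root , _) 𝒪⇔ℤ[ρ] =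
  ω-indecomposable 𝒪⇔ℤ[ρ] ,
  (δ , δ∈𝒪^∨⁺ 𝒪⇔ℤ[ρ] , δ-hasTrace ω ω³ value-ω) , trace-bound 𝒪⇔ℤ[ρ]
  where
  open Main a ρ (Cubic.simplestCubic-root a ρ-root)
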